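{- There is a single-valued $\mathsf{F\Sigma_2P}$ algorithm $A$: for every $n$ and every circuit $C:\{0,1\}^n\to\{0,1\}^{2n}$ given as input, $A(C)$ outputs some $y_C\in\{0,1\}^{2n}$ with $y_C\notin\mathrm{Im}(C)$.
   Context: A single-valued $\mathsf{F\Sigma_2P}$ algorithm $A$ is specified by a polynomial $\ell(\cdot)$ and a deterministic polynomial-time algorithm $V_A(x,\pi_1,\pi_2)$. On input $x$, $A$ outputs $y_x$ if (1) there is $\pi_1\in\{0,1\}^{\ell(|x|)}$ such that for every $\pi_2\in\{0,1\}^{\ell(|x|)}$, $V_A(x,\pi_1,\pi_2)=y_x$, and (2) for every $\pi_1\in\{0,1\}^{\ell(|x|)}$ there is $\pi_2\in\{0,1\}^{\ell(|x|)}$ such that $V_A(x,\pi_1,\pi_2)\in\{y_x,\bot\}$. -}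

module Defs where

open import Data.Bool using (Bool; true; false)
open import Data.Fin using (Fin; toℕ)
open import Data.List using (List; []; _∷_; _++_; length; foldr; replicate; concatMap)
open import Data.Maybe using (Maybe; just; nothing)
open import Data.Nat using (ℕ; suc; _+_; _*_; _≤_)
open import Data.Product using (∃-syntax; Σ-syntax; _×_)
open import Data.Sum using (_⊎_)
open import Data.Vec as Vec using (Vec; lookup; _[_]≔_; toList)
open import Relation.Binary.PropositionalEquality using (_≡_; _≢_)

Bits : Set
Bits = List Bool

Polynomial : Set
Polynomial = List ℕ

-- a₀ ∷ a₁ ∷ … ∷ a_d ∷ [] stands for a₀ + a₁ n + … + a_d n^d.
⟪_⟫ : Polynomial → ℕ → ℕ
⟪ p ⟫ n = foldr (λ a r → a + n * r) 0 p

-- The model of deterministic computation is the WHILE language over binary trees of N. D. Jones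
-- ("Computability and Complexity from a Programming Perspective"): finitely
-- many variables holding pointers to immutable cons cells, every elementary
-- operation costing one time unit.  It has the same polynomial-time functions
-- on strings as Turing machines: a tape is a pair of lists, each move of which
-- takes O(1) operations; conversely each operation allocates at most one cell
-- or follows one pointer, so a run of t steps is simulated on a heap with at
-- most t cells beyond the input.  There is no unit-cost tree comparison beyond
-- the test for nil, so the exponentially large trees that sharing can denote
-- give no extra power.

data Tree : Set where
  nil  : Tree
  cons : Tree → Tree → Tree

left : Tree → Tree
left nil        = nil
left (cons s t) = s

right : Tree → Tree
right nil        = nil
right (cons s t) = t

data Expr (k : ℕ) : Set where
  var   : Fin k → Expr k
  nil   : Expr k
  cons  : Expr k → Expr k → Expr k
  hd tl : Expr k → Expr k

infix  20 _≔_
infixr 10 _⨾_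

data Command (k : ℕ) : Set where
  _≔_           : Fin k → Expr k → Command k
  _⨾_           : Command k → Command k → Command k
  if_then_else_ : Expr k → Command k → Command k → Command k
  while_loop_   : Expr k → Command k → Command k

Store : ℕ → Set
Store k = Vec Tree k

value : ∀ {k} → Expr k → Store k → Tree
value (var i)    σ = lookup σ i
value nil        σ = nil
value (cons e f) σ = cons (value e σ) (value f σ)
value (hd e)     σ = left (value e σ)
value (tl e)     σ = right (value e σ)

cost : ∀ {k} → Expr k → ℕ
cost (var i)    = 1
cost nil        = 1
cost (cons e f) = suc (cost e + cost f)
cost (hd e)     = suc (cost e)
cost (tl e)     = suc (cost e)

infix 4 _,_⇓[_]_

-- c , σ ⇓[ t ] σ′ : started in σ, the command c halts in σ′ after time t.
-- In tests nil is false and every other tree is true.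
data _,_⇓[_]_ {k : ℕ} : Command k → Store k → ℕ → Store k → Set where
  assign     : ∀ {i e σ} →
               i ≔ e , σ ⇓[ suc (cost e) ] (σ [ i ]≔ value e σ)
  seq        : ∀ {c d σ σ′ σ″ t u} →
               c , σ ⇓[ t ] σ′ → d , σ′ ⇓[ u ] σ″ →
               c ⨾ d , σ ⇓[ t + u ] σ″
  if-true    : ∀ {e c d σ σ′ t} → value e σ ≢ nil → c , σ ⇓[ t ] σ′ →
               if e then c else d , σ ⇓[ suc (cost e) + t ] σ′
  if-false   : ∀ {e c d σ σ′ t} → value e σ ≡ nil → d , σ ⇓[ t ] σ′ →
               if e then c else d , σ ⇓[ suc (cost e) + t ] σ′
  while-stop : ∀ {e c σ} → value e σ ≡ nil →
               while e loop c , σ ⇓[ suc (cost e) ] σ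
  while-step : ∀ {e c σ σ′ σ″ t u} → value e σ ≢ nil →
               c , σ ⇓[ t ] σ′ → while e loop c , σ′ ⇓[ u ] σ″ →
               while e loop c , σ ⇓[ suc (cost e) + (t + u) ] σ″

bitTree : Bool → Tree
bitTree false = nil
bitTree true  = cons nil nil

bitsTree : Bits → Tree
bitsTree []       = nil
bitsTree (b ∷ bs) = cons (bitTree b) (bitsTree bs)

-- nothing is the answer ⊥.
answerTree : Maybe Bits → Tree
answerTree nothing  = nil
answerTree (just y) = cons nil (bitsTree y)

-- The inputs are the first three variables, the answer is left in the first.
initial : ∀ r → Bits → Bits → Bits → Store (3 + r)
initial r x π₁ π₂ =
  bitsTree x Vec.∷ bitsTree π₁ Vec.∷ bitsTree π₂ Vec.∷ Vec.replicate r nil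

PolynomialTime : (Bits → Bits → Bits → Maybe Bits) → Set
PolynomialTime V =
  ∃[ r ] Σ[ program ∈ Command (3 + r) ] Σ[ p ∈ Polynomial ]
    (∀ x π₁ π₂ → ∃[ t ] ∃[ σ ]
      (program , initial r x π₁ π₂ ⇓[ t ] σ) ×
      t ≤ ⟪ p ⟫ (length x + length π₁ + length π₂) ×
      Vec.head σ ≡ answerTree (V x π₁ π₂))

record SingleValuedFΣ₂P : Set where
  field
    ℓ      : Polynomial
    V      : Bits → Bits → Bits → Maybe Bits
    V-time : PolynomialTime V

Outputs : SingleValuedFΣ₂P → Bits → Bits → Set
Outputs A x y =
  (∃[ π₁ ] ∀ π₂ → verdict π₁ π₂ ≡ just y) ×
  (∀ π₁ → ∃[ π₂ ] (verdict π₁ π₂ ≡ just y ⊎ verdict π₁ π₂ ≡ nothing))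
  where
  open SingleValuedFΣ₂P A
  verdict : Vec Bool (⟪ ℓ ⟫ (length x)) → Vec Bool (⟪ ℓ ⟫ (length x)) → Maybe Bits
  verdict π₁ π₂ = V x (toList π₁) (toList π₂)

-- A gate computes an arbitrary function of two earlier wires, given by its
-- values at 00, 01, 10, 11 (so AND, OR, NOT and constants are all available).
record Gate (k : ℕ) : Set where
  constructor gate
  field
    t₀₀ t₀₁ t₁₀ t₁₁ : Bool
    in₁ in₂         : Fin k

-- Straight-line sequences of gates.  The wires available at a gate are numbered
-- backwards: 0 is the output of the preceding gate, and the circuit inputs, in
-- order, come after all gates.
infixr 5 _∷_

data Gates : ℕ → ℕ → Set where
  []  : ∀ {k} → Gates k k
  _∷_ : ∀ {k w} → Gate k → Gates (suc k) w → Gates k w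

record Circuit (n m : ℕ) : Set where
  constructor circuit
  field
    {wires} : ℕ
    gates   : Gates n wires
    outputs : Vec (Fin wires) m

table : ∀ {k} → Gate k → Bool → Bool → Bool
table g false false = Gate.t₀₀ g
table g false true  = Gate.t₀₁ g
table g true  false = Gate.t₁₀ g
table g true  true  = Gate.t₁₁ g

run : ∀ {k w} → Gates k w → Vec Bool k → Vec Bool w
run []       v = v
run (g ∷ gs) v =
  run gs (table g (lookup v (Gate.in₁ g)) (lookup v (Gate.in₂ g)) Vec.∷ v)

⟦_⟧ : ∀ {n m} → Circuit n m → Vec Bool n → Vec Bool m
⟦ C ⟧ x = Vec.map (lookup (run (Circuit.gates C) x)) (Circuit.outputs C)

_∈Im_ : ∀ {n m} → Vec Bool m → Circuit n m → Set
y ∈Im C = ∃[ x ] ⟦ C ⟧ x ≡ y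

-- Numbers in circuit descriptions are written in unary, which changes the
-- length of a description only polynomially.

unary : ℕ → Bits
unary n = replicate n true ++ false ∷ []

encodeGate : ∀ {k} → Gate k → Bits
encodeGate (gate a b c d i j) = a ∷ b ∷ c ∷ d ∷ unary (toℕ i) ++ unary (toℕ j)

-- Each gate is announced by true; false ends the sequence.
encodeGates : ∀ {k w} → Gates k w → Bits
encodeGates []       = false ∷ []
encodeGates (g ∷ gs) = true ∷ encodeGate g ++ encodeGates gs

encode : ∀ {n m} → Circuit n m → Bits
encode {n} C =
  unary n ++ encodeGates (Circuit.gates C) ++
  concatMap (λ i → unary (toℕ i)) (toList (Circuit.outputs C))

{-# OPTIONS --safe #-}
module Submission where

-- Regard C as a map doubling the length of seeds and consider the complete
-- binary tree of depth n whose leaf at q carries a string differing from what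
-- one gets by expanding the seed q along the path q.  Label the tree in
-- postorder: an inner node gets the first string that C maps to the pair of the
-- labels of its children.  The root cannot get a label v, since expanding v would
-- then reproduce all leaves, in particular the one at v.  So some node, first in
-- postorder, fails, and the labels of its children form a string outside the
-- image of C.  Although the tree is exponentially large, the labels of all
-- earlier nodes are obtained by expanding the labels of the left siblings on the
-- path to the failing node.  π₁ lists these, and π₂ picks a leaf and a
-- string z that may refute the labels on the path to that leaf, by being an
-- earlier preimage, or the answer, by being a preimage.  No wrong π₁ survives all
-- challenges, because labels are unique.

open import Data.Bool using (Bool; true; false; not) renaming (if_then_else_ to when_then_else_)
import Data.Bool.Properties as Bool
open import Data.Fin using (Fin; zero; suc; toℕ)
open import Data.List using ([]; _∷_; _++_; length; foldl; replicate; reverse; concatMap; _ʳ++_)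
open import Data.List.Properties using (++-assoc; ++-identityʳ; ++-ʳ++; length-++; length-replicate;
  length-reverse; reverse-involutive)
open import Data.Maybe as Maybe using (Maybe; just; nothing; _<∣>_; is-nothing)
open import Data.Nat using (ℕ; zero; suc; _+_; _*_; _≤_; _≥_; z≤n; s≤s)
open import Data.Nat.Properties
open import Data.Nat.Tactic.RingSolver using (solve-∀)
open import Data.Product using (∃; ∃-syntax; Σ-syntax; _×_; _,_; proj₁; proj₂)
open import Data.Sum as Sum using (_⊎_; inj₁; inj₂)
open import Data.Vec as Vec using (Vec; []; _∷_; toList; lookup; _[_]≔_)
import Data.Vec.Properties as Vec
open import Function using (_∘_)
open import Relation.Nullary using (¬_; Dec; contradiction; yes; no)
open import Relation.Unary using (Decidable)
open import Relation.Binary.PropositionalEquality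
open import Defs

-- Terms compiled to polynomial-time WHILE programs

-- iter t u applies u to t as many times as the input x has bits; this is the
-- only form of repetition, so every term runs in polynomial time no matter how
-- large the trees it builds are.
data Term : ℕ → Set where
  ‵_      : ∀ {k} → Fin k → Term k
  ∅       : ∀ {k} → Term k
  _▹_     : ∀ {k} → Term k → Term k → Term k
  fst snd : ∀ {k} → Term k → Term k
  cond    : ∀ {k} → Term k → Term k → Term k → Term k
  bind    : ∀ {k} → Term k → Term (suc k) → Term k
  call    : ∀ {k m} → Term m → Vec (Term k) m → Term k
  iter    : ∀ {k} → Term k → Term (suc k) → Term k

infix  30 ‵_
infixr 15 _▹_

branch : Tree → Tree → Tree → Tree
branch nil        s t = t
branch (cons _ _) s t = s

iterate : ∀ {A : Set} → (A → A) → ℕ → A → A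
iterate f zero    t = t
iterate f (suc m) t = iterate f m (f t)

mutual
  eval : ∀ {k} → ℕ → Term k → Vec Tree k → Tree
  eval N (‵ i)        ρ = lookup ρ i
  eval N ∅            ρ = nil
  eval N (t ▹ u)      ρ = cons (eval N t ρ) (eval N u ρ)
  eval N (fst t)      ρ = left (eval N t ρ)
  eval N (snd t)      ρ = right (eval N t ρ)
  eval N (cond t u v) ρ = branch (eval N t ρ) (eval N u ρ) (eval N v ρ)
  eval N (bind t u)   ρ = eval N u (eval N t ρ ∷ ρ)
  eval N (call f ts)  ρ = eval N f (evals N ts ρ)
  eval N (iter t u)   ρ = iterate (λ s → eval N u (s ∷ ρ)) N (eval N t ρ)

  evals : ∀ {k m} → ℕ → Vec (Term k) m → Vec Tree k → Vec Tree m
  evals N []       ρ = []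
  evals N (t ∷ ts) ρ = eval N t ρ ∷ evals N ts ρ

-- Polynomial time bounds for runs of commands

infixl 6 _⊕_

_⊕_ : Polynomial → Polynomial → Polynomial
[]      ⊕ q       = q
(a ∷ p) ⊕ []      = a ∷ p
(a ∷ p) ⊕ (b ∷ q) = a + b ∷ p ⊕ q

⟪⟫-⊕ : ∀ p q n → ⟪ p ⊕ q ⟫ n ≡ ⟪ p ⟫ n + ⟪ q ⟫ n
⟪⟫-⊕ []      q       n = refl
⟪⟫-⊕ (a ∷ p) []      n = sym (+-identityʳ _)
⟪⟫-⊕ (a ∷ p) (b ∷ q) n rewrite ⟪⟫-⊕ p q n = lemma a b n (⟪ p ⟫ n) (⟪ q ⟫ n)
  where
  lemma : ∀ a b n p q → a + b + n * (p + q) ≡ a + n * p + (b + n * q)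
  lemma = solve-∀

⟪⟫-mono : ∀ p {m n} → m ≤ n → ⟪ p ⟫ m ≤ ⟪ p ⟫ n
⟪⟫-mono []      m≤n = z≤n
⟪⟫-mono (a ∷ p) m≤n = +-monoʳ-≤ a (*-mono-≤ m≤n (⟪⟫-mono p m≤n))

-- A time bound for commands all of whose loops make at most n iterations.
bound : ∀ {k} → Command k → Polynomial
bound (i ≔ e)                = suc (cost e) ∷ []
bound (c ⨾ d)                = bound c ⊕ bound d
bound (if e then c else d)   = (suc (cost e) ∷ []) ⊕ (bound c ⊕ bound d)
bound (while e loop c)       = suc (cost e) ∷ (suc (cost e) ∷ []) ⊕ bound c

record Runs {k} (n : ℕ) (c : Command k) (σ σ′ : Store k) : Set where
  constructor runs
  field
    {time} : ℕ
    halts  : c , σ ⇓[ time ] σ′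
    intime : time ≤ ⟪ bound c ⟫ n

cons≢nil : ∀ {s t} → Tree.cons s t ≢ Tree.nil
cons≢nil ()

module _ {k n : ℕ} where

  infixr 10 _⨟_

  set : ∀ {i : Fin k} {e σ} → Runs n (i ≔ e) σ (σ [ i ]≔ value e σ)
  set = runs assign (m≤m+n _ _)

  _⨟_ : ∀ {c d : Command k} {σ σ′ σ″} →
        Runs n c σ σ′ → Runs n d σ′ σ″ → Runs n (c ⨾ d) σ σ″
  _⨟_ {c} {d} (runs r t≤) (runs s u≤) = runs (seq r s)
    (≤-trans (+-mono-≤ t≤ u≤) (≤-reflexive (sym (⟪⟫-⊕ (bound c) (bound d) n))))

  private
    branch-bound : ∀ {m} a p q → m ≤ ⟪ p ⟫ n + ⟪ q ⟫ n →
                   a + m ≤ ⟪ (a ∷ []) ⊕ (p ⊕ q) ⟫ n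
    branch-bound {m} a p q m≤ = begin
      a + m                          ≤⟨ +-mono-≤ (m≤m+n a (n * 0)) m≤ ⟩
      ⟪ a ∷ [] ⟫ n + (⟪ p ⟫ n + ⟪ q ⟫ n) ≡⟨ cong (⟪ a ∷ [] ⟫ n +_) (⟪⟫-⊕ p q n) ⟨
      ⟪ a ∷ [] ⟫ n + ⟪ p ⊕ q ⟫ n     ≡⟨ ⟪⟫-⊕ (a ∷ []) (p ⊕ q) n ⟨
      ⟪ (a ∷ []) ⊕ (p ⊕ q) ⟫ n       ∎
      where open ≤-Reasoning

  -- Runs of both branches are supplied, so that callers need not know the outcome of the test; the
  -- two equations identify the store reached by the branch taken with a common one.
  run-if : ∀ {e} {c d : Command k} {σ σ₁ σ₂} → Runs n c σ σ₁ → Runs n d σ σ₂ →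
           ∀ {σ′} → (value e σ ≢ nil → σ₁ ≡ σ′) → (value e σ ≡ nil → σ₂ ≡ σ′) →
           Runs n (if e then c else d) σ σ′
  run-if {e} {c} {d} {σ} (runs r t≤) (runs s u≤) then′ else′ with value e σ in eq
  ... | nil with refl ← else′ refl =
    runs (if-false eq s) (branch-bound _ (bound c) (bound d) (≤-trans u≤ (m≤n+m _ _)))
  ... | cons _ _ with refl ← then′ cons≢nil =
    runs (if-true (subst (_≢ nil) (sym eq) cons≢nil) r)
         (branch-bound _ (bound c) (bound d) (≤-trans t≤ (m≤m+n _ _)))

-- Compilation of terms

environment : ∀ {k} → Vec Tree k → Tree
environment []      = nil
environment (t ∷ ρ) = cons t (environment ρ)

-- The registers of compiled terms: the clock, that is the input x; the list of
-- the values of the variables; the result; and a stack of saved values.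
pattern K = zero
pattern E = suc zero
pattern R = suc (suc zero)
pattern S = suc (suc (suc zero))

tails : ∀ {k} → Fin k → Expr 4
tails zero    = var E
tails (suc i) = tl (tails i)

push pop : Command 4
push = S ≔ cons (var R) (var S)
pop  = S ≔ tl (var S)

enter leave : Command 4
enter = E ≔ cons (var R) (var E)
leave = E ≔ tl (var E)

mutual
  compile : ∀ {k} → Term k → Command 4
  compile (‵ i)        = R ≔ hd (tails i)
  compile ∅            = R ≔ nil
  compile (t ▹ u)      = compile t ⨾ push ⨾ compile u ⨾ R ≔ cons (hd (var S)) (var R) ⨾ pop
  compile (fst t)      = compile t ⨾ R ≔ hd (var R)
  compile (snd t)      = compile t ⨾ R ≔ tl (var R)
  compile (cond t u v) = compile t ⨾ if var R then compile u else compile v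
  compile (bind t u)   = compile t ⨾ enter ⨾ compile u ⨾ leave
  -- The stack cell that delivered the argument list is reused to save the environment of the
  -- caller.
  compile (call f ts)  = compiles ts ⨾ R ≔ hd (var S) ⨾ S ≔ cons (var E) (tl (var S)) ⨾
                         E ≔ var R ⨾ compile f ⨾ E ≔ hd (var S) ⨾ pop
  -- The copy of the input on the stack is the loop counter, from which `body` removes one cell per
  -- round. Nested loops push copies of their own.
  compile (iter t u)   = compile t ⨾ S ≔ cons (var K) (var S) ⨾
                         while hd (var S) loop body u ⨾ pop

  -- Pushes the environment made of the values of the arguments.
  compiles : ∀ {k m} → Vec (Term k) m → Command 4
  compiles []       = S ≔ cons nil (var S)
  compiles (t ∷ ts) = compiles ts ⨾ compile t ⨾ S ≔ cons (cons (var R) (hd (var S))) (tl (var S))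

  body : ∀ {k} → Term (suc k) → Command 4
  body u = enter ⨾ compile u ⨾ leave ⨾ S ≔ cons (tl (hd (var S))) (tl (var S))

value-tails : ∀ {k} (i : Fin k) (ρ : Vec Tree k) {c r s} →
              left (value (tails i) (c ∷ environment ρ ∷ r ∷ s ∷ [])) ≡ lookup ρ i
value-tails i ρ {c} {r} {s} = go i ρ refl
  where
  σ : Tree → Store 4
  σ e = c ∷ e ∷ r ∷ s ∷ []
  -- The tail taken last may be taken first, so that the induction can strip the environment from
  -- the front.
  value-suc : ∀ {k} (i : Fin k) e → right (value (tails i) (σ e)) ≡ value (tails i) (σ (right e))
  value-suc zero    e = refl
  value-suc (suc i) e = cong right (value-suc i e)
  go : ∀ {k} (i : Fin k) (ρ : Vec Tree k) {e} → e ≡ environment ρ →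
       left (value (tails i) (σ e)) ≡ lookup ρ i
  go zero    (t ∷ ρ) refl = refl
  go (suc i) (t ∷ ρ) refl = trans (cong left (value-suc i _)) (go i ρ refl)

module _ (x : Bits) where

  private
    N = length x

    state : ∀ {k} → Vec Tree k → Tree → Tree → Store 4
    state ρ r s = bitsTree x ∷ environment ρ ∷ r ∷ s ∷ []

  mutual
    -- Since environment and stack are restored, the runs of subterms can be chained with `⨟`.
    compile-runs : ∀ {k} (t : Term k) ρ {r s} →
                   Runs N (compile t) (state ρ r s) (state ρ (eval N t ρ) s)
    compile-runs (‵ i) ρ {r} {s} =
      subst (λ v → Runs N (R ≔ hd (tails i)) (state ρ r s) (state ρ v s)) (value-tails i ρ) set
    compile-runs ∅ ρ = set
    compile-runs (t ▹ u) ρ = compile-runs t ρ ⨟ set ⨟ compile-runs u ρ ⨟ set ⨟ set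
    compile-runs (fst t) ρ = compile-runs t ρ ⨟ set
    compile-runs (snd t) ρ = compile-runs t ρ ⨟ set
    compile-runs (cond t u v) ρ {s = s} =
      compile-runs t ρ ⨟ run-if (compile-runs u ρ) (compile-runs v ρ)
        (λ ≢nil → cong (λ w → state ρ w s) (chosen (eval N t ρ) ≢nil))
        (λ ≡nil → cong (λ w → state ρ (branch w (eval N u ρ) (eval N v ρ)) s) (sym ≡nil))
      where
      chosen : ∀ b {y z} → b ≢ nil → y ≡ branch b y z
      chosen nil        ≢nil with () ← ≢nil refl
      chosen (cons _ _) ≢nil = refl
    compile-runs (bind t u) ρ =
      compile-runs t ρ ⨟ set ⨟ compile-runs u (eval N t ρ ∷ ρ) ⨟ set
    compile-runs (call f ts) ρ =
      let _ , run = compiles-runs ts ρ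
      in  run ⨟ set ⨟ set ⨟ set ⨟ compile-runs f (evals N ts ρ) ⨟ set ⨟ set
    compile-runs (iter t u) ρ = compile-runs t ρ ⨟ set ⨟ loop ⨟ set
      where
      loop : ∀ {r s} → Runs N (while hd (var S) loop body u) (state ρ r (cons (bitsTree x) s))
                         (state ρ (iterate (λ v → eval N u (v ∷ ρ)) N r) (cons nil s))
      loop with (t , r , t≤) ← loop-runs u ρ x = runs r (begin
        t                                      ≤⟨ t≤ ⟩
        3 + N * (3 + b)                        ≤⟨ +-monoʳ-≤ 3 (*-monoʳ-≤ N (+-monoˡ-≤ b (m≤m+n 3 (N * 0)))) ⟩
        3 + N * (⟪ 3 ∷ [] ⟫ N + b)             ≡⟨ cong (λ c → 3 + N * c) (⟪⟫-⊕ (3 ∷ []) (bound (body u)) N) ⟨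
        ⟪ bound (while hd (var S) loop body u) ⟫ N ∎)
        where
        open ≤-Reasoning
        b = ⟪ bound (body u) ⟫ N

    compiles-runs : ∀ {k m} (ts : Vec (Term k) m) ρ {r s} → ∃[ r′ ]
      Runs N (compiles ts) (state ρ r s) (state ρ r′ (cons (environment (evals N ts ρ)) s))
    compiles-runs []       ρ = _ , set
    compiles-runs (t ∷ ts) ρ =
      let _ , run = compiles-runs ts ρ in _ , run ⨟ compile-runs t ρ ⨟ set

    -- Only the remaining counter `ys` shrinks in the induction, while the body is always charged
    -- for the full input length `N`. The 3 is the price of one test of `hd (var S)`.
    loop-runs : ∀ {k} (u : Term (suc k)) ρ (ys : Bits) {r s} → ∃[ t ]
      (while hd (var S) loop body u , state ρ r (cons (bitsTree ys) s) ⇓[ t ]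
        state ρ (iterate (λ v → eval N u (v ∷ ρ)) (length ys) r) (cons nil s)) ×
      t ≤ 3 + length ys * (3 + ⟪ bound (body u) ⟫ N)
    loop-runs u ρ []       = _ , while-stop refl , ≤-refl
    loop-runs u ρ (y ∷ ys) {r} {s} =
      let runs {t} run t≤ = set ⨟ compile-runs u (r ∷ ρ) ⨟ set ⨟ set
          t′ , run′ , t′≤ = loop-runs u ρ ys
      in  3 + (t + t′) , while-step cons≢nil run run′ , bounds t≤ t′≤
      where
      regroup : ∀ b l → 3 + (b + (3 + l)) ≡ 3 + (3 + b + l)
      regroup = solve-∀
      bounds : ∀ {t t′ b l} → t ≤ b → t′ ≤ 3 + l → 3 + (t + t′) ≤ 3 + (3 + b + l)
      bounds {b = b} {l} t≤ t′≤ =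
        ≤-trans (+-monoʳ-≤ 3 (+-mono-≤ t≤ t′≤)) (≤-reflexive (regroup b l))

-- The lexicographic order on bit strings

differ : Bool → Bool → Maybe Bool
differ false false = nothing
differ false true  = just true
differ true  false = just false
differ true  true  = nothing

-- nothing for equal strings, otherwise whether the first one precedes the second.
compareBits : ∀ {n} → Vec Bool n → Vec Bool n → Maybe Bool
compareBits []      []      = nothing
compareBits (a ∷ u) (b ∷ v) = differ a b <∣> compareBits u v

compareBits-refl : ∀ {n} (u : Vec Bool n) → compareBits u u ≡ nothing
compareBits-refl []          = refl
compareBits-refl (false ∷ u) = compareBits-refl u
compareBits-refl (true  ∷ u) = compareBits-refl u

compareBits⇒≡ : ∀ {n} (u v : Vec Bool n) → compareBits u v ≡ nothing → u ≡ v
compareBits⇒≡ []          []          eq = refl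
compareBits⇒≡ (false ∷ u) (false ∷ v) eq = cong (false ∷_) (compareBits⇒≡ u v eq)
compareBits⇒≡ (true  ∷ u) (true  ∷ v) eq = cong (true ∷_) (compareBits⇒≡ u v eq)

compareBits-flip : ∀ {n} (u v : Vec Bool n) →
                   compareBits u v ≡ just false → compareBits v u ≡ just true
compareBits-flip []          []          ()
compareBits-flip (false ∷ u) (false ∷ v) eq = compareBits-flip u v eq
compareBits-flip (true  ∷ u) (true  ∷ v) eq = compareBits-flip u v eq
compareBits-flip (true  ∷ u) (false ∷ v) eq = refl

IsFirst : ∀ {n} → (Vec Bool n → Set) → Vec Bool n → Set
IsFirst P v = P v × (∀ u → compareBits u v ≡ just true → ¬ P u)

first : ∀ {n} {P : Vec Bool n → Set} → Decidable P → ∃ (IsFirst P) ⊎ (∀ v → ¬ P v)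
first {zero} P? with P? []
... | yes p = inj₁ ([] , p , λ { [] () })
... | no ¬p = inj₂ (λ { [] → ¬p })
first {suc n} P? with first (P? ∘ (false ∷_))
... | inj₁ (v , p , min) = inj₁ (false ∷ v , p , λ { (false ∷ u) → min u ; (true ∷ u) () })
... | inj₂ none with first (P? ∘ (true ∷_))
...   | inj₁ (v , p , min) =
          inj₁ (true ∷ v , p , λ { (true ∷ u) → min u ; (false ∷ u) _ → none u })
...   | inj₂ none′ = inj₂ (λ { (false ∷ v) → none v ; (true ∷ v) → none′ v })

first-unique : ∀ {n} {P : Vec Bool n → Set} {u v} → IsFirst P u → IsFirst P v → u ≡ v
first-unique {u = u} {v} (p , min) (q , min′) with compareBits u v in eq
... | nothing    = compareBits⇒≡ u v eq
... | just true  = contradiction p (min′ u eq)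
... | just false = contradiction q (min v (compareBits-flip u v eq))

_≟ᵛ_ : ∀ {n} (u v : Vec Bool n) → Dec (u ≡ v)
_≟ᵛ_ = Vec.≡-dec Bool._≟_

-- Total readers of bit strings: missing bits are false.

headBit : Bits → Bool
headBit []      = false
headBit (b ∷ _) = b

tailBits : Bits → Bits
tailBits []      = []
tailBits (_ ∷ s) = s

read : ∀ n → Bits → Vec Bool n × Bits
read zero    s = [] , s
read (suc n) s = let v , s′ = read n (tailBits s) in headBit s ∷ v , s′

read-toList : ∀ {n} (v : Vec Bool n) s → read n (toList v ++ s) ≡ (v , s)
read-toList []      s = refl
read-toList (b ∷ v) s rewrite read-toList v s = refl

-- Has no fixed points when n ≥ 1, which is what the diagonal argument asks for.
flipHead : ∀ {n} → Vec Bool n → Vec Bool n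
flipHead []      = []
flipHead (b ∷ v) = not b ∷ v

flipHead-≢ : ∀ {n} → n ≥ 1 → (v : Vec Bool n) → flipHead v ≢ v
flipHead-≢ (s≤s _) (b ∷ v) eq = Bool.not-¬ refl (sym (Vec.∷-injectiveˡ eq))

-- The definition is chosen so that the type computes to Vec Bool (2 * n).
join : ∀ {n} → Vec Bool n × Vec Bool n → Vec Bool (2 * n)
join (u , v) = u Vec.++ (v Vec.++ [])

half : ∀ n → Bool → Vec Bool (2 * n) → Vec Bool n
half n false y = proj₁ (read n (toList y))
half n true y = proj₁ (read n (proj₂ (read n (toList y))))

toList-join : ∀ {n} (u v : Vec Bool n) → toList (join (u , v)) ≡ toList u ++ toList v ++ []
toList-join u v = trans (Vec.toList-++ u _) (cong (toList u ++_) (Vec.toList-++ v []))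

half-join : ∀ {n} b (u v : Vec Bool n) → half n b (join (u , v)) ≡ (when b then v else u)
half-join {n} false u v rewrite toList-join u v | read-toList u (toList v ++ []) = refl
half-join {n} true  u v
  rewrite toList-join u v | read-toList u (toList v ++ []) | read-toList v [] = refl

join-half : ∀ n (y : Vec Bool (2 * n)) → join (half n false y , half n true y) ≡ y
join-half n y with Vec.splitAt n y
... | u , w , refl with Vec.splitAt n w
...   | v , [] , refl = cong₂ (λ s t → join (s , t)) (half-join false u v) (half-join true u v)

half-injective : ∀ n (y z : Vec Bool (2 * n)) →
                 half n false y ≡ half n false z → half n true y ≡ half n true z → y ≡ z
half-injective n y z eq eq′ =
  trans (sym (join-half n y)) (trans (cong₂ (λ u v → join (u , v)) eq eq′) (join-half n z))

-- The labelled tree and its certificates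

-- One row for each node on the path to the failing one: if stop, this is the
-- failing node and u and v are the labels of its children; otherwise, if onRight,
-- the path goes right and u is the label of the left child; otherwise it goes left.
record Row (n : ℕ) : Set where
  constructor row
  field
    stop onRight : Bool
    u v          : Vec Bool n

rowBits : ∀ {n} → Row n → Bits
rowBits (row t w u v) = t ∷ w ∷ toList u ++ toList v

readRow : ∀ {n} → Bits → Row n × Bits
readRow {n} s =
  let u , s₁ = read n (tailBits (tailBits s))
      v , s₂ = read n s₁
  in  row (headBit s) (headBit (tailBits s)) u v , s₂

readRow-rowBits : ∀ {n} (r : Row n) s → readRow (rowBits r ++ s) ≡ (r , s)
readRow-rowBits (row t w u v) s
  rewrite ++-assoc (toList u) (toList v) s | read-toList u (toList v ++ s) | read-toList v s = refl

rows : ∀ {n} d → Bits → Vec (Row n) d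
rows zero    s = []
rows (suc d) s = let r , s′ = readRow s in r ∷ rows d s′

rowsBits : ∀ {n d} → Vec (Row n) d → Bits
rowsBits []       = []
rowsBits (r ∷ rs) = rowBits r ++ rowsBits rs

rows-rowsBits : ∀ {n d} (rs : Vec (Row n) d) s → rows d (rowsBits rs ++ s) ≡ rs
rows-rowsBits []       s = refl
rows-rowsBits (r ∷ rs) s = trans
  (cong (λ (r , s) → r ∷ rows _ s) (trans
    (cong readRow (++-assoc (rowBits r) (rowsBits rs) s))
    (readRow-rowBits r (rowsBits rs ++ s))))
  (cong (r ∷_) (rows-rowsBits rs s))

length-rowsBits : ∀ {n d} (rs : Vec (Row n) d) → length (rowsBits rs) ≡ d * (2 + (n + n))
length-rowsBits []       = refl
length-rowsBits (r@(row _ _ u v) ∷ rs) = trans (length-++ (rowBits r)) (cong₂ _+_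
  (cong (2 +_) (trans (length-++ (toList u)) (cong₂ _+_ (Vec.length-toList u) (Vec.length-toList v))))
  (length-rowsBits rs))

-- descend: the node is an ancestor of the failing one; holds v: v is claimed
-- to be the label of the node; decided b: nothing remains to be checked.
data Mode (n : ℕ) : Set where
  descend : Mode n
  holds   : Vec Bool n → Mode n
  decided : Bool → Mode n

enterRow : ∀ {n} → Row n → Bool → Mode n
enterRow (row true  _     u v) b = holds (when b then v else u)
enterRow (row false true  u v) b = when b then descend else holds u
-- Where the path goes left, the right subtree comes after the failing node in postorder, so
-- challenges into it are accepted.
enterRow (row false false u v) b = when b then decided true else descend

-- The first comparison is between the images of z and v, the second between z and v themselves: z
-- refutes v by being an earlier string with the same image.
refutes : Maybe Bool → Maybe Bool → Bool
refutes nothing (just b) = b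
refutes nothing nothing  = false
refutes (just _) _       = false

accepts : ∀ {n} → Mode n → Vec Bool n → Bool
-- If a check started in `descend` also ends there, no row stops; then `candidate` is `nothing` and
-- `conclude` answers ⊥.
accepts descend     t = true
accepts (holds v)   t = is-nothing (compareBits v t)
accepts (decided b) t = b

-- Labels, the failing node, and completeness and soundness of certificates

module Korten {n : ℕ} (C : Vec Bool n → Vec Bool (2 * n)) where

  private V = Vec Bool n

  child : Bool → V → V
  child b v = half n b (C v)

  walk : ∀ {d} → V → Vec Bool d → V
  walk v []      = v
  walk v (b ∷ q) = walk (child b v) q

  checkValue : V → V → Bool → Mode n
  checkValue z v b =
    when refutes (compareBits (C z) (C v)) (compareBits z v) then decided false else holds (child b v)

  step : V → Row n → Mode n → Bool → Mode n
  step z r descend     b = enterRow r b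
  step z r (holds v)   b = checkValue z v b
  step z r (decided c) b = decided c

  check : ∀ {d} → V → Mode n → Vec (Row n) d → Vec Bool d → Mode n
  check z m []       []      = m
  check z m (r ∷ rs) (b ∷ q) = check z (step z r m b) rs q

  candidate : ∀ {d} → Vec (Row n) d → Maybe (V × V)
  candidate []                 = nothing
  candidate (row t _ u v ∷ rs) = when t then just (u , v) else candidate rs

  conclude : Maybe (V × V) → V → Bool → Maybe (V × V)
  conclude nothing  z ok = nothing
  conclude (just y) z ok = when is-nothing (compareBits (C z) (join y)) then nothing else
                           when ok then just y else nothing

  verdict : ∀ {d} → (Vec Bool d → V) → Vec (Row n) d → Vec Bool d → V → Maybe (V × V)
  verdict g rs q z = conclude (candidate rs) z (accepts (check z descend rs q) (g q))

  -- Taking depth n makes seeds and paths strings of the same length, so that a seed can serve as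
  -- its own path.
  target : V → V
  target q = flipHead (walk q q)

  -- In `node` the halves of `C v` are the labels of the children, so the preimages of these labels
  -- are the strings with the same image as v.
  SameImage : V → V → Set
  SameImage v u = C u ≡ C v

  -- Value d g v: every node of a complete tree of depth d whose leaves carry g
  -- gets a label, namely the first preimage of the labels of its children, and
  -- the label of the root is v.
  data Value : ∀ d → (Vec Bool d → V) → V → Set where
    leaf : ∀ {g} → Value zero g (g [])
    node : ∀ {d g v} → Value d (g ∘ (false ∷_)) (child false v) →
           Value d (g ∘ (true ∷_)) (child true v) →
           IsFirst (SameImage v) v → Value (suc d) g v

  -- Failure d g y: the first node in postorder without a label has children with
  -- the labels y.
  data Failure : ∀ d → (Vec Bool d → V) → V × V → Set where
    onLeft  : ∀ {d g y} → Failure d (g ∘ (false ∷_)) y → Failure (suc d) g y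
    onRight : ∀ {d g u y} → Value d (g ∘ (false ∷_)) u →
              Failure d (g ∘ (true ∷_)) y → Failure (suc d) g y
    here    : ∀ {d g u v} → Value d (g ∘ (false ∷_)) u → Value d (g ∘ (true ∷_)) v →
              (∀ x → C x ≢ join (u , v)) → Failure (suc d) g (u , v)

  -- By induction the halves of `C u` and `C v` agree, so u and v are both first among the same
  -- preimages.
  value-unique : ∀ {d g u v} → Value d g u → Value d g v → u ≡ v
  value-unique leaf leaf = refl
  value-unique (node {v = u} l r min) (node {v = v} l′ r′ min′) =
    first-unique min (subst (λ y → IsFirst (λ x → C x ≡ y) v) (sym eq) min′)
    where
    eq : C u ≡ C v
    eq = half-injective n (C u) (C v) (value-unique l l′) (value-unique r r′)

  -- At the failing node a label would be a preimage of the labels of the children.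
  value-¬failure : ∀ {d g v y} → Value d g v → ¬ Failure d g y
  value-¬failure (node l r _) (onLeft f)    = value-¬failure l f
  value-¬failure (node l r _) (onRight _ f) = value-¬failure r f
  value-¬failure (node {v = w} l r _) (here {u = u} {v} l′ r′ none) = none w
    (half-injective n (C w) (join (u , v))
      (trans (value-unique l l′) (sym (half-join false u v)))
      (trans (value-unique r r′) (sym (half-join true u v))))

  -- A failure in a subtree excludes a label of its root, so two failures take the same turns and
  -- stop at the same node.
  failure-unique : ∀ {d g y z} → Failure d g y → Failure d g z → y ≡ z
  failure-unique (onLeft f)    (onLeft f′)    = failure-unique f f′
  failure-unique (onLeft f)    (onRight l _)  = contradiction f (value-¬failure l)
  failure-unique (onLeft f)    (here l _ _)   = contradiction f (value-¬failure l)
  failure-unique (onRight l _) (onLeft f)     = contradiction f (value-¬failure l)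
  failure-unique (onRight _ f) (onRight _ f′) = failure-unique f f′
  failure-unique (onRight _ f) (here _ r _)   = contradiction f (value-¬failure r)
  failure-unique (here l _ _)  (onLeft f)     = contradiction f (value-¬failure l)
  failure-unique (here _ r _)  (onRight _ f)  = contradiction f (value-¬failure r)
  failure-unique (here l r _)  (here l′ r′ _) = cong₂ _,_ (value-unique l l′) (value-unique r r′)

  failure-avoids : ∀ {d g y} → Failure d g y → ∀ x → C x ≢ join y
  failure-avoids (onLeft f)      = failure-avoids f
  failure-avoids (onRight _ f)   = failure-avoids f
  failure-avoids (here _ _ none) = none

  merge : ∀ {d g u v} → Value d (g ∘ (false ∷_)) u → Value d (g ∘ (true ∷_)) v →
          ∃ (Value (suc d) g) ⊎ ∃ (Failure (suc d) g)
  merge {u = u} {v} l r with first (λ x → C x ≟ᵛ join (u , v))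
  ... | inj₂ none = inj₂ (_ , here l r none)
  ... | inj₁ (x , eq , min) = inj₁ (x , node
    (subst (Value _ _) (sym (trans (cong (half n false) eq) (half-join false u v))) l)
    (subst (Value _ _) (sym (trans (cong (half n true) eq) (half-join true u v))) r)
    (subst (λ y → IsFirst (λ z → C z ≡ y) x) (sym eq) (eq , min)))

  value-or-failure : ∀ d g → ∃ (Value d g) ⊎ ∃ (Failure d g)
  value-or-failure zero    g = inj₁ (g [] , leaf)
  value-or-failure (suc d) g
    with value-or-failure d (g ∘ (false ∷_)) | value-or-failure d (g ∘ (true ∷_))
  ... | inj₂ (y , f) | _            = inj₂ (y , onLeft f)
  ... | inj₁ (u , l) | inj₂ (y , f) = inj₂ (y , onRight l f)
  ... | inj₁ (u , l) | inj₁ (v , r) = merge l r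

  -- Each label is a half of the image of the label above it, so the root label alone determines all
  -- leaves.
  value-walk : ∀ {d g v} → Value d g v → ∀ q → g q ≡ walk v q
  value-walk leaf         []          = refl
  value-walk (node l r _) (false ∷ q) = value-walk l q
  value-walk (node l r _) (true  ∷ q) = value-walk r q

  check-decided : ∀ {d} z c rs (q : Vec Bool d) → check z (decided c) rs q ≡ decided c
  check-decided z c []       []      = refl
  check-decided z c (r ∷ rs) (b ∷ q) = check-decided z c rs q

  refutes-first : ∀ {v} → IsFirst (SameImage v) v → ∀ z →
                  refutes (compareBits (C z) (C v)) (compareBits z v) ≡ false
  refutes-first {v} (_ , min) z with compareBits (C z) (C v) in eq | compareBits z v in eq′
  ... | nothing | just true  = contradiction (compareBits⇒≡ (C z) (C v) eq) (min z eq′)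
  ... | nothing | just false = refl
  ... | nothing | nothing    = refl
  ... | just _  | _          = refl

  value-accepted : ∀ {d g v} → Value d g v → ∀ rs q z →
                   accepts (check z (holds v) rs q) (g q) ≡ true
  value-accepted {g = g} leaf [] [] z rewrite compareBits-refl (g []) = refl
  value-accepted (node l r min) (_ ∷ rs) (false ∷ q) z
    rewrite refutes-first min z = value-accepted l rs q z
  value-accepted (node l r min) (_ ∷ rs) (true ∷ q) z
    rewrite refutes-first min z = value-accepted r rs q z

  Rejected : ∀ {d} → (Vec Bool d → V) → V → Vec (Row n) d → Set
  Rejected g v rs = ∃[ q ] ∃[ z ] accepts (check z (holds v) rs q) (g q) ≡ false

  -- The z found for the subtree may refute v already at this node; then the rejection only comes
  -- earlier.
  rejected-below : ∀ {d g v} b r (rs : Vec (Row n) d) →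
                   Rejected (g ∘ (b ∷_)) (child b v) rs → Rejected g v (r ∷ rs)
  rejected-below {g = g} {v} b r rs (q , z , eq) = b ∷ q , z , lemma
    where
    lemma : accepts (check z (checkValue z v b) rs q) (g (b ∷ q)) ≡ false
    lemma with refutes (compareBits (C z) (C v)) (compareBits z v)
    ... | true  rewrite check-decided z false rs q = refl
    ... | false = eq

  -- Wrong claims at leaves are visible directly. If the labels of both children are right, v can
  -- only go wrong by not being first, and then the first string with the same image is the
  -- challenge.
  value-sound : ∀ {d} g v (rs : Vec (Row n) d) → Value d g v ⊎ Rejected g v rs
  value-sound g v [] with compareBits v (g []) in eq
  ... | nothing rewrite compareBits⇒≡ v (g []) eq = inj₁ leaf
  ... | just _  = inj₂ ([] , v , cong is-nothing eq)
  value-sound {suc d} g v (r ∷ rs)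
    with value-sound (g ∘ (false ∷_)) (child false v) rs
       | value-sound (g ∘ (true ∷_)) (child true v) rs
  ... | inj₂ rej | _        = inj₂ (rejected-below false r rs rej)
  ... | inj₁ _   | inj₂ rej = inj₂ (rejected-below true r rs rej)
  ... | inj₁ lv  | inj₁ rv with first (λ x → C x ≟ᵛ C v)
  ...   | inj₂ none = contradiction refl (none v)
  ...   | inj₁ (m , eq , min) with compareBits m v in cmp
  ...     | nothing rewrite compareBits⇒≡ m v cmp = inj₁ (node lv rv (refl , min))
  ...     | just false = contradiction refl (min v (compareBits-flip m v cmp))
  -- Every path below is equally good, because m refutes v at the present node.
  ...     | just true  = inj₂ (false ∷ Vec.replicate d false , m , lemma _ _)
    where
    lemma : ∀ q t → accepts (check m (checkValue m v false) rs q) t ≡ false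
    lemma q t rewrite eq | compareBits-refl (C v) | cmp | check-decided m false rs q = refl

  failure-certificate : ∀ {d g y} → Failure d g y → ∃[ rs ] candidate rs ≡ just y ×
    (∀ q z → accepts (check z descend rs q) (g q) ≡ true)
  failure-certificate {y = u , v} (onLeft f) with failure-certificate f
  ... | rs , eq , acc = row false false u v ∷ rs , eq , λ
    { (false ∷ q) z → acc q z
    ; (true  ∷ q) z → cong (λ m → accepts m _) (check-decided z true rs q) }
  failure-certificate (onRight {u = u} l f) with failure-certificate f
  ... | rs , eq , acc = row false true u u ∷ rs , eq , λ
    { (false ∷ q) z → value-accepted l rs q z
    ; (true  ∷ q) z → acc q z }
  failure-certificate (here {d} {u = u} {v} l r _) = r₀ ∷ rs , refl , λ
    { (false ∷ q) z → value-accepted l rs q z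
    ; (true  ∷ q) z → value-accepted r rs q z }
    where
    -- The rows below the failing node are padding, repeated up to the depth of the tree.
    r₀ = row true true u v
    rs = Vec.replicate d r₀

  conclude-false : ∀ y z → conclude y z false ≡ nothing
  conclude-false nothing  z = refl
  conclude-false (just y) z with is-nothing (compareBits (C z) (join y))
  ... | true  = refl
  ... | false = refl

  -- Follows the claimed path: `value-sound` tests the claimed labels hanging off it, and at the
  -- stopping row a preimage of the answer is itself a challenge, on whichever path.
  failure-sound : ∀ {d} g (rs : Vec (Row n) d) {y} → candidate rs ≡ just y →
    Failure d g y ⊎ ∃[ q ] ∃[ z ] verdict g rs q z ≡ nothing
  failure-sound {suc d} g rs′@(row true w u v ∷ rs) refl
    with value-sound (g ∘ (false ∷_)) u rs | value-sound (g ∘ (true ∷_)) v rs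
  ... | inj₂ (q , z , eq) | _ = inj₂ (false ∷ q , z ,
    trans (cong (conclude (candidate rs′) z) eq) (conclude-false (candidate rs′) z))
  ... | inj₁ _ | inj₂ (q , z , eq) = inj₂ (true ∷ q , z ,
    trans (cong (conclude (candidate rs′) z) eq) (conclude-false (candidate rs′) z))
  ... | inj₁ l | inj₁ r with first (λ x → C x ≟ᵛ join (u , v))
  ...   | inj₂ none = inj₁ (here l r none)
  ...   | inj₁ (x , eq , _) = inj₂ (Vec.replicate (suc d) false , x , lemma)
    where
    lemma : ∀ {ok} → conclude (just (u , v)) x ok ≡ nothing
    lemma rewrite eq | compareBits-refl (join (u , v)) = refl
  failure-sound g rs′@(row false true u v ∷ rs) eq
    with value-sound (g ∘ (false ∷_)) u rs
  ... | inj₂ (q , z , rej) = inj₂ (false ∷ q , z ,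
    trans (cong (conclude (candidate rs′) z) rej) (conclude-false (candidate rs′) z))
  ... | inj₁ l with failure-sound (g ∘ (true ∷_)) rs eq
  ...   | inj₁ f             = inj₁ (onRight l f)
  ...   | inj₂ (q , z , rej) = inj₂ (true ∷ q , z , rej)
  failure-sound g rs′@(row false false u v ∷ rs) eq with failure-sound (g ∘ (false ∷_)) rs eq
  ... | inj₁ f             = inj₁ (onLeft f)
  ... | inj₂ (q , z , rej) = inj₂ (false ∷ q , z , rej)

  verdict-choices : ∀ {d} g (rs : Vec (Row n) d) {y} → candidate rs ≡ just y → ∀ q z →
                    verdict g rs q z ≡ just y ⊎ verdict g rs q z ≡ nothing
  verdict-choices g rs {y} eq q z
    rewrite eq with is-nothing (compareBits (C z) (join y)) | accepts (check z descend rs q) (g q)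
  ... | true  | _     = inj₂ refl
  ... | false | true  = inj₁ refl
  ... | false | false = inj₂ refl

  root-failure : n ≥ 1 → ∃ (Failure n target)
  root-failure n≥1 with value-or-failure n target
  ... | inj₂ f       = f
  ... | inj₁ (v , t) = contradiction (value-walk t v) (flipHead-≢ n≥1 (walk v v))

  honest : ∀ {y} → Failure n target y → ∃[ rs ] ∀ q z → verdict target rs q z ≡ just y
  honest {y} f with failure-certificate f
  ... | rs , eq , acc = rs , lemma
    where
    lemma : ∀ q z → verdict target rs q z ≡ just y
    lemma q z rewrite eq | acc q z with compareBits (C z) (join y) in cmp
    ... | nothing = contradiction (compareBits⇒≡ _ _ cmp) (failure-avoids f z)
    ... | just _  = refl

  -- Without a candidate every challenge gives ⊥. With one, either some challenge refutes the
  -- certificate or it describes a true failure, whose labels are y by uniqueness.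
  single-valued : ∀ {y} → Failure n target y → ∀ rs → ∃[ q ] ∃[ z ]
    (verdict target rs q z ≡ just y ⊎ verdict target rs q z ≡ nothing)
  single-valued {y} f rs = by-candidate (candidate rs) refl
    where
    z₀ = Vec.replicate n false
    by-candidate : ∀ c → candidate rs ≡ c → ∃[ q ] ∃[ z ]
      (verdict target rs q z ≡ just y ⊎ verdict target rs q z ≡ nothing)
    by-candidate nothing   eq = z₀ , z₀ ,
      inj₂ (cong (λ c → conclude c z₀ (accepts (check z₀ descend rs z₀) (target z₀))) eq)
    by-candidate (just y′) eq with failure-sound target rs eq
    ... | inj₂ (q , z , rej) = q , z , inj₂ rej
    ... | inj₁ f′ rewrite failure-unique f f′ = z₀ , z₀ , verdict-choices target rs eq z₀ z₀

-- Loops over bit strings in the term language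

pattern v₀ = ‵ zero
pattern v₁ = ‵ suc zero
pattern v₂ = ‵ suc (suc zero)
pattern v₃ = ‵ suc (suc (suc zero))
pattern v₄ = ‵ suc (suc (suc (suc zero)))
pattern v₅ = ‵ suc (suc (suc (suc (suc zero))))
pattern v₆ = ‵ suc (suc (suc (suc (suc (suc zero)))))

left-bitsTree : ∀ s → left (bitsTree s) ≡ bitTree (headBit s)
left-bitsTree []      = refl
left-bitsTree (b ∷ s) = refl

right-bitsTree : ∀ s → right (bitsTree s) ≡ bitsTree (tailBits s)
right-bitsTree []      = refl
right-bitsTree (b ∷ s) = refl

branch-bitTree : ∀ b {s t} → branch (bitTree b) s t ≡ (when b then s else t)
branch-bitTree false = refl
branch-bitTree true  = refl

-- Every `iter` makes exactly N rounds; once the list is used up the state is fixed, and the surplus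
-- rounds are harmless.
iterate-fixed : ∀ {A : Set} (f : A → A) m {a} → f a ≡ a → iterate f m a ≡ a
iterate-fixed f zero    eq = refl
iterate-fixed f (suc m) eq = trans (cong (iterate f m) eq) (iterate-fixed f m eq)

opaque

  -- The variables of the body are the accumulator, the current element and the
  -- state of the loop (which it has no use for), followed by those of the context.
  fold : ∀ {k} → Term k → Term k → Term (3 + k) → Term k
  fold l i u = snd (iter (l ▹ i)
    (cond (fst v₀) (snd (fst v₀) ▹ bind (fst (fst v₀)) (bind (snd v₁) u)) v₀))

  -- Applies u once for each true in front of the first false.
  scan : ∀ {k} → Term k → Term k → Term (2 + k) → Term k
  scan l i u = iter (l ▹ i) (cond (fst (fst v₀)) (snd (fst v₀) ▹ bind (snd v₀) u) v₀)

module _ (N : ℕ) {A : Set} (enc : A → Tree) {k} (ρ : Vec Tree k) where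

  opaque
    unfolding fold scan

    eval-fold : ∀ {l i u} (f : A → Bool → A) →
      (∀ a b s → eval N u (enc a ∷ bitTree b ∷ s ∷ ρ) ≡ enc (f a b)) →
      ∀ bs {a} → length bs ≤ N → eval N l ρ ≡ bitsTree bs → eval N i ρ ≡ enc a →
      eval N (fold l i u) ρ ≡ enc (foldl f a bs)
    eval-fold {u = u} f step bs {a} bs≤ l≡ i≡ rewrite l≡ | i≡ = cong right (go N bs a bs≤)
      where
      F : Tree → Tree
      F s = eval N (cond (fst v₀) (snd (fst v₀) ▹ bind (fst (fst v₀)) (bind (snd v₁) u)) v₀) (s ∷ ρ)
      go : ∀ m bs a → length bs ≤ m →
           iterate F m (cons (bitsTree bs) (enc a)) ≡ cons nil (enc (foldl f a bs))
      go m       []       a _        = iterate-fixed F m refl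
      go (suc m) (b ∷ bs) a (s≤s ≤m) =
        trans (cong (iterate F m ∘ cons _) (step a b _)) (go m bs (f a b) ≤m)

    -- The terminating `false` stays in the list: it keeps the final state fixed, whatever bits
    -- follow.
    eval-scan : ∀ {l i u} (f : A → A) → (∀ a s → eval N u (enc a ∷ s ∷ ρ) ≡ enc (f a)) →
      ∀ j {rest a} → j ≤ N → eval N l ρ ≡ bitsTree (unary j ++ rest) → eval N i ρ ≡ enc a →
      eval N (scan l i u) ρ ≡ cons (bitsTree (false ∷ rest)) (enc (iterate f j a))
    eval-scan {u = u} f step j {rest} {a} j≤ l≡ i≡ rewrite l≡ | i≡ = go N j a j≤
      where
      F : Tree → Tree
      F s = eval N (cond (fst (fst v₀)) (snd (fst v₀) ▹ bind (snd v₀) u) v₀) (s ∷ ρ)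
      go : ∀ m j a → j ≤ m → iterate F m (cons (bitsTree (unary j ++ rest)) (enc a)) ≡
                             cons (bitsTree (false ∷ rest)) (enc (iterate f j a))
      go m       zero    a _        = iterate-fixed F m refl
      go (suc m) (suc j) a (s≤s ≤m) =
        trans (cong (iterate F m ∘ cons _) (step a _)) (go m j (f a) ≤m)

-- Bit strings

prefix-≤ : ∀ (as {bs} : Bits) {m} → length (as ++ bs) ≤ m → length as ≤ m
prefix-≤ as ≤m = ≤-trans (m≤m+n _ _) (≤-trans (≤-reflexive (sym (length-++ as))) ≤m)

suffix-≤ : ∀ (as {bs} : Bits) {m} → length (as ++ bs) ≤ m → length bs ≤ m
suffix-≤ as ≤m = ≤-trans (m≤n+m _ (length as)) (≤-trans (≤-reflexive (sym (length-++ as))) ≤m)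

-- Also turns an arbitrary tree into the representation of a bit string.
opaque
  revOnto : Term 2
  revOnto = fold v₀ v₁ (cond v₁ (∅ ▹ ∅) ∅ ▹ v₀)

  eval-revOnto : ∀ N bs as → length bs ≤ N →
    eval N revOnto (bitsTree bs ∷ bitsTree as ∷ []) ≡ bitsTree (bs ʳ++ as)
  eval-revOnto N bs as bs≤ = eval-fold N bitsTree _ (λ as b → b ∷ as)
    (λ { as false s → refl ; as true s → refl }) bs bs≤ refl refl

opaque
  unfolding fold revOnto

  -- Malformed inputs may lead to arbitrary trees. Each round that changes the accumulator puts a
  -- genuine bit in front of it, so it remains a bit string.
  revOnto-canonical : ∀ N t as → ∃[ bs ] eval N revOnto (t ∷ bitsTree as ∷ []) ≡ bitsTree bs
  revOnto-canonical N t as = go N t as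
    where
    F : Tree → Tree
    F s = eval N (cond (fst v₀) (snd (fst v₀) ▹ bind (fst (fst v₀)) (bind (snd v₁)
            (cond v₁ (∅ ▹ ∅) ∅ ▹ v₀))) v₀) (s ∷ t ∷ bitsTree as ∷ [])
    go : ∀ m t as → ∃[ bs ] right (iterate F m (cons t (bitsTree as))) ≡ bitsTree bs
    go zero    t                   as = as , refl
    go (suc m) nil                 as = go m nil as
    go (suc m) (cons nil t)        as = go m t (false ∷ as)
    go (suc m) (cons (cons _ _) t) as = go m t (true ∷ as)

opaque
  rev : Term 1
  rev = call revOnto (v₀ ∷ ∅ ∷ [])

  append : Term 2
  append = call rev (call revOnto (v₁ ∷ call revOnto (v₀ ∷ ∅ ∷ []) ∷ []) ∷ [])

  eval-rev : ∀ N bs → length bs ≤ N → eval N rev (bitsTree bs ∷ []) ≡ bitsTree (reverse bs)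
  eval-rev N bs = eval-revOnto N bs []

  rev-canonical : ∀ N t → ∃[ bs ] eval N rev (t ∷ []) ≡ bitsTree bs
  rev-canonical N t = revOnto-canonical N t []

  eval-append : ∀ N as bs → length (as ++ bs) ≤ N →
    eval N append (bitsTree as ∷ bitsTree bs ∷ []) ≡ bitsTree (as ++ bs)
  eval-append N as bs ≤N
    rewrite eval-revOnto N as [] (prefix-≤ as ≤N)
          | eval-revOnto N bs (as ʳ++ []) (suffix-≤ as ≤N)
          | sym (++-ʳ++ as {bs} {[]}) =
    trans (eval-rev N (reverse (as ++ bs)) (≤-trans (≤-reflexive (length-reverse (as ++ bs))) ≤N))
          (cong bitsTree (reverse-involutive (as ++ bs)))

opaque
  -- The first argument is the length of the first part, in unary.
  split : Term 2
  split = bind (fold v₀ (∅ ▹ v₁) ((fst (snd v₀) ▹ fst v₀) ▹ snd (snd v₀)))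
               (call rev (fst v₀ ∷ []) ▹ snd v₀)

ones : ℕ → Bits
ones n = replicate n true

cons₂ : ∀ {s s′ t t′} → s ≡ s′ → t ≡ t′ → Tree.cons s t ≡ Tree.cons s′ t′
cons₂ = cong₂ Tree.cons

pairTree : ∀ {A B : Set} → (A → Tree) → (B → Tree) → A × B → Tree
pairTree f g (a , b) = cons (f a) (g b)

opaque
  unfolding split

  eval-split : ∀ {N} n s → n ≤ N → let v , s′ = read n s in
    eval N split (bitsTree (ones n) ∷ bitsTree s ∷ []) ≡ cons (bitsTree (toList v)) (bitsTree s′)
  eval-split {N} n s n≤ =
    trans (cong (λ t → cons (eval N rev (left t ∷ [])) (right t)) loop)
          (cons₂ (trans (eval-rev N (toList v ʳ++ []) short)
                        (cong bitsTree (reverse-involutive (toList v)))) refl)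
    where
    v : Vec Bool n
    v = proj₁ (read n s)
    short : length (reverse (toList v)) ≤ N
    short = ≤-trans (≤-reflexive (trans (length-reverse (toList v)) (Vec.length-toList v))) n≤
    step : Bits × Bits → Bool → Bits × Bits
    step (acc , s) _ = headBit s ∷ acc , tailBits s
    steps : ∀ n acc s → foldl step (acc , s) (ones n) ≡
            (toList (proj₁ (read n s)) ʳ++ acc , proj₂ (read n s))
    steps zero    acc s = refl
    steps (suc n) acc s = steps n (headBit s ∷ acc) (tailBits s)
    loop : eval N (fold v₀ (∅ ▹ v₁) ((fst (snd v₀) ▹ fst v₀) ▹ snd (snd v₀)))
             (bitsTree (ones n) ∷ bitsTree s ∷ []) ≡
           cons (bitsTree (toList v ʳ++ [])) (bitsTree (proj₂ (read n s)))
    loop = trans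
      (eval-fold N (pairTree bitsTree bitsTree) (bitsTree (ones n) ∷ bitsTree s ∷ [])
        {l = v₀} {i = ∅ ▹ v₁} {u = (fst (snd v₀) ▹ fst v₀) ▹ snd (snd v₀)} step
        (λ (acc , s) b _ → cons₂ (cons₂ (left-bitsTree s) refl) (right-bitsTree s)) (ones n)
        (≤-trans (≤-reflexive (length-replicate n)) n≤) refl refl)
      (cong (pairTree bitsTree bitsTree) (steps n [] s))

comparisonTree : Maybe Bool → Tree
comparisonTree nothing  = nil
comparisonTree (just b) = cons (bitTree b) nil

opaque
  compare : Term 2
  compare = fst (fold v₀ (∅ ▹ v₁)
    (cond (fst v₀) (fst v₀)
      (cond v₁ (cond (fst (snd v₀)) ∅ (∅ ▹ ∅)) (cond (fst (snd v₀)) ((∅ ▹ ∅) ▹ ∅) ∅)) ▹ snd (snd v₀)))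

  eval-compare : ∀ {N n} (u v : Vec Bool n) → n ≤ N →
    eval N compare (bitsTree (toList u) ∷ bitsTree (toList v) ∷ []) ≡ comparisonTree (compareBits u v)
  eval-compare {N} {n} u v n≤ = cong left (trans
    (eval-fold N (pairTree comparisonTree bitsTree) _ {l = v₀} {i = ∅ ▹ v₁} step
      (λ (c , s) b _ → cons₂ (eval-step c s b) (right-bitsTree s))
      (toList u) (≤-trans (≤-reflexive (Vec.length-toList u)) n≤) refl refl)
    (cong (pairTree comparisonTree bitsTree) (steps u v nothing)))
    where
    step : Maybe Bool × Bits → Bool → Maybe Bool × Bits
    step (c , s) b = c <∣> differ b (headBit s) , tailBits s
    eval-step : ∀ c s b → branch (comparisonTree c) (comparisonTree c)
      (branch (bitTree b) (branch (left (bitsTree s)) nil (cons nil nil))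
                          (branch (left (bitsTree s)) (cons (cons nil nil) nil) nil)) ≡
      comparisonTree (c <∣> differ b (headBit s))
    eval-step (just _) s         b     = refl
    eval-step nothing  []          false = refl
    eval-step nothing  []          true  = refl
    eval-step nothing  (false ∷ _) false = refl
    eval-step nothing  (true ∷ _)  false = refl
    eval-step nothing  (false ∷ _) true  = refl
    eval-step nothing  (true ∷ _)  true  = refl
    steps : ∀ {n} (u v : Vec Bool n) c →
            foldl step (c , toList v) (toList u) ≡ (c <∣> compareBits u v , [])
    steps []      []      nothing  = refl
    steps []      []      (just _) = refl
    steps (a ∷ u) (b ∷ v) (just c) = steps u v (just c)
    steps (a ∷ u) (b ∷ v) nothing  = trans (steps u v (differ a b)) refl

-- Circuits

opaque
  -- Reads a unary number off the first argument; returns what follows it and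
  -- the entry of the second argument with that number.
  fetch : Term 2
  fetch = bind (scan v₀ v₁ (snd v₀)) (snd (fst v₀) ▹ fst (snd v₀))

  eval-fetch : ∀ {N k} (w : Vec Bool k) (i : Fin k) rest → toℕ i ≤ N →
    eval N fetch (bitsTree (unary (toℕ i) ++ rest) ∷ bitsTree (toList w) ∷ []) ≡
    cons (bitsTree rest) (bitTree (lookup w i))
  eval-fetch {N} w i rest i≤ =
    trans (cong (λ t → cons (right (left t)) (left (right t)))
      (eval-scan N bitsTree _ {l = v₀} {i = v₁} {u = snd v₀} tailBits
        (λ s _ → right-bitsTree s) (toℕ i) i≤ refl refl))
      (cons₂ refl (trans (left-bitsTree (iterate tailBits (toℕ i) (toList w)))
                         (cong bitTree (entry w i))))
    where
    entry : ∀ {k} (w : Vec Bool k) i → headBit (iterate tailBits (toℕ i) (toList w)) ≡ lookup w i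
    entry (b ∷ w) zero    = refl
    entry (b ∷ w) (suc i) = entry w i

opaque
  addGate : Term 2
  addGate = bind (call fetch (snd (snd (snd (snd v₀))) ∷ v₁ ∷ []))
    (bind (call fetch (fst v₀ ∷ v₂ ∷ []))
      (fst v₀ ▹ cond (snd v₁)
        (cond (snd v₀) (fst (snd (snd (snd v₂)))) (fst (snd (snd v₂))))
        (cond (snd v₀) (fst (snd v₂)) (fst v₂)) ▹ v₃))

length-unary : ∀ j rest → length (unary j ++ rest) ≡ suc (j + length rest)
length-unary zero    rest = refl
length-unary (suc j) rest = cong suc (length-unary j rest)

unary-≤ : ∀ {m} j rest → length (unary j ++ rest) ≤ m → j ≤ m
unary-≤ j rest ≤m = ≤-trans (m≤m+n j (length rest))
  (≤-trans (n≤1+n _) (subst (_≤ _) (length-unary j rest) ≤m))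

rest-≤ : ∀ {m} j rest → length (unary j ++ rest) ≤ m → length rest ≤ m
rest-≤ j rest ≤m = ≤-trans (m≤n+m (length rest) j)
  (≤-trans (n≤1+n _) (subst (_≤ _) (length-unary j rest) ≤m))

opaque
  unfolding addGate

  eval-addGate : ∀ {N k} (g : Gate k) (w : Vec Bool k) rest → length (encodeGate g ++ rest) ≤ N →
    let open Gate g in
    eval N addGate (bitsTree (encodeGate g ++ rest) ∷ bitsTree (toList w) ∷ []) ≡
    cons (bitsTree rest) (bitsTree (table g (lookup w in₁) (lookup w in₂) ∷ toList w))
  eval-addGate {N} g@(gate a b c d i j) w rest ≤N
    rewrite ++-assoc (unary (toℕ i)) (unary (toℕ j)) rest
          | eval-fetch {N} w i (unary (toℕ j) ++ rest) (unary-≤ (toℕ i) _ (≤-trans (m≤n+m _ 4) ≤N))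
          | eval-fetch {N} w j rest (unary-≤ (toℕ j) rest (rest-≤ (toℕ i) _ (≤-trans (m≤n+m _ 4) ≤N)))
    with lookup w i | lookup w j
  ... | false | false = refl
  ... | false | true  = refl
  ... | true  | false = refl
  ... | true  | true  = refl

outputBits : ∀ {w m} → Vec (Fin w) m → Bits
outputBits is = concatMap (λ i → unary (toℕ i)) (toList is)

opaque
  runGates : Term 2
  runGates = iter (v₀ ▹ v₁) (cond (fst (fst v₀)) (call addGate (snd (fst v₀) ∷ snd v₀ ∷ [])) v₀)

  -- Each gate uses up at least one bit of the description, so N rounds reach the end.
  eval-runGates : ∀ {N k w} (gs : Gates k w) v rest → length (encodeGates gs ++ rest) ≤ N →
    eval N runGates (bitsTree (encodeGates gs ++ rest) ∷ bitsTree (toList v) ∷ []) ≡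
    cons (bitsTree (false ∷ rest)) (bitsTree (toList (run gs v)))
  eval-runGates {N} gs v rest ≤N = go N gs v ≤N ≤N
    where
    F : Tree → Tree
    F t = branch (left (left t)) (eval N addGate (right (left t) ∷ right t ∷ [])) t
    go : ∀ m {k w} (gs : Gates k w) v → length (encodeGates gs ++ rest) ≤ m →
         length (encodeGates gs ++ rest) ≤ N →
         iterate F m (cons (bitsTree (encodeGates gs ++ rest)) (bitsTree (toList v))) ≡
         cons (bitsTree (false ∷ rest)) (bitsTree (toList (run gs v)))
    go m       []       v _        _  = iterate-fixed F m refl
    go (suc m) (g ∷ gs) v (s≤s ≤m) ≤N =
      trans (cong (λ s → iterate F m (F (cons (bitsTree (true ∷ s)) (bitsTree (toList v))))) assoc)
        (trans (cong (iterate F m)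
                 (eval-addGate g v (encodeGates gs ++ rest) (reassoc (≤-trans (n≤1+n _) ≤N))))
               (go m gs _ (shorter ≤m) (shorter (≤-trans (n≤1+n _) ≤N))))
      where
      assoc : (encodeGate g ++ encodeGates gs) ++ rest ≡ encodeGate g ++ encodeGates gs ++ rest
      assoc = ++-assoc (encodeGate g) (encodeGates gs) rest
      reassoc : ∀ {l} → length ((encodeGate g ++ encodeGates gs) ++ rest) ≤ l →
                length (encodeGate g ++ encodeGates gs ++ rest) ≤ l
      reassoc {l} = subst (λ s → length s ≤ l) assoc
      shorter : ∀ {l} → length ((encodeGate g ++ encodeGates gs) ++ rest) ≤ l →
                length (encodeGates gs ++ rest) ≤ l
      shorter ≤l = suffix-≤ (encodeGate g) (reassoc ≤l)

  -- The arguments are the wires and the description of the outputs.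
  readOutputs : Term 2
  readOutputs = bind (iter (v₁ ▹ ∅) (cond (fst v₀)
      (bind (call fetch (fst v₀ ∷ v₁ ∷ [])) (fst v₀ ▹ snd v₀ ▹ snd v₁)) v₀))
    (call rev (snd v₀ ∷ []))

  eval-readOutputs : ∀ {N k m} (w : Vec Bool k) (is : Vec (Fin k) m) → length (outputBits is) ≤ N →
    eval N readOutputs (bitsTree (toList w) ∷ bitsTree (outputBits is) ∷ []) ≡
    bitsTree (toList (Vec.map (lookup w) is))
  eval-readOutputs {N} w is ≤N =
    trans (cong (λ t → eval N rev (right t ∷ [])) (go N is [] ≤N ≤N))
      (trans (eval-rev N (reverse outs) (≤-trans (≤-reflexive (length-reverse outs)) (short is ≤N)))
             (cong bitsTree (reverse-involutive outs)))
    where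
    outs : Bits
    outs = toList (Vec.map (lookup w) is)
    F : Tree → Tree
    F t = branch (left t) (eval N (fst v₀ ▹ snd v₀ ▹ snd v₁)
            (eval N fetch (left t ∷ bitsTree (toList w) ∷ []) ∷ t ∷ [])) t
    -- Even zero is written with one bit, so the description is empty exactly when no output is
    -- left.
    nonempty : ∀ j rest {s t} → branch (bitsTree (unary j ++ rest)) s t ≡ s
    nonempty zero    rest = refl
    nonempty (suc j) rest = refl
    short : ∀ {m l} (is : Vec _ m) → length (outputBits is) ≤ l →
            length (toList (Vec.map (lookup w) is)) ≤ l
    short []       ≤l = z≤n
    short (i ∷ is) ≤l with subst (_≤ _) (length-unary (toℕ i) (outputBits is)) ≤l
    ... | s≤s ≤l′ = s≤s (short is (≤-trans (m≤n+m _ (toℕ i)) ≤l′))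
    go : ∀ l {m} (is : Vec _ m) acc → length (outputBits is) ≤ l → length (outputBits is) ≤ N →
         iterate F l (cons (bitsTree (outputBits is)) (bitsTree acc)) ≡
         cons nil (bitsTree (toList (Vec.map (lookup w) is) ʳ++ acc))
    go l []       acc _ _ = iterate-fixed F l refl
    go l (i ∷ is) acc ≤l ≤N with subst (_≤ _) (length-unary (toℕ i) (outputBits is)) ≤l
    go (suc l) (i ∷ is) acc _ ≤N | s≤s ≤l =
      trans (cong (iterate F l) (trans (nonempty (toℕ i) (outputBits is))
              (cong (λ t → cons (left t) (cons (right t) (bitsTree acc)))
                    (eval-fetch w i (outputBits is) (unary-≤ (toℕ i) _ ≤N)))))
            (go l is (lookup w i ∷ acc) (≤-trans (m≤n+m _ (toℕ i)) ≤l) (rest-≤ (toℕ i) _ ≤N))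

  evalCircuit : Term 2
  evalCircuit = bind (call runGates (v₀ ∷ v₁ ∷ [])) (call readOutputs (snd v₀ ∷ snd (fst v₀) ∷ []))

circuitBits : ∀ {n m} → Circuit n m → Bits
circuitBits C = encodeGates (Circuit.gates C) ++ outputBits (Circuit.outputs C)

opaque
  unfolding evalCircuit

  eval-evalCircuit : ∀ {N n m} (C : Circuit n m) x → length (circuitBits C) ≤ N →
    eval N evalCircuit (bitsTree (circuitBits C) ∷ bitsTree (toList x) ∷ []) ≡
    bitsTree (toList (⟦ C ⟧ x))
  eval-evalCircuit {N} C x ≤N
    rewrite eval-runGates (Circuit.gates C) x (outputBits (Circuit.outputs C)) ≤N =
    eval-readOutputs (run (Circuit.gates C) x) (Circuit.outputs C)
      (suffix-≤ (encodeGates (Circuit.gates C)) ≤N)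

rowTree : ∀ {n} → Row n → Tree
rowTree (row t w u v) =
  cons (cons (bitTree t) (bitTree w)) (cons (bitsTree (toList u)) (bitsTree (toList v)))

modeTree : ∀ {n} → Mode n → Tree
modeTree descend     = nil
modeTree (holds v)   = cons nil (bitsTree (toList v))
modeTree (decided b) = cons (cons nil nil) (bitTree b)

answerBits : ∀ {n} → Vec Bool n × Vec Bool n → Bits
answerBits = toList ∘ join

-- The verifier

-- The comment above each term names its variables: u is n in unary, c describes
-- the gates and the outputs of the circuit, s starts with rows, r is a row, m a mode.

opaque
  -- u s
  readRowTerm : Term 2
  readRowTerm = bind (call split (v₀ ∷ snd (snd v₁) ∷ []))
    (bind (call split (v₁ ∷ snd v₀ ∷ []))
      (((fst v₃ ▹ fst (snd v₃)) ▹ fst v₁ ▹ fst v₀) ▹ snd v₀))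

opaque
  -- u s
  candidateTerm : Term 2
  candidateTerm = fst (fold v₀ (∅ ▹ v₁) (bind (call readRowTerm (v₃ ∷ snd v₀ ∷ []))
    (cond (fst v₁) (fst v₁)
      (cond (fst (fst (fst v₀)))
        (∅ ▹ call append (fst (snd (fst v₀)) ∷ snd (snd (fst v₀)) ∷ [])) ∅) ▹ snd v₀)))

opaque
  -- u c v b
  childTerm : Term 4
  childTerm = bind (call split (v₀ ∷ call evalCircuit (v₁ ∷ v₂ ∷ []) ∷ []))
    (cond v₄ (fst (call split (v₁ ∷ snd v₀ ∷ []))) (fst v₀))

opaque
  -- u c v q
  walkTerm : Term 4
  walkTerm = fold v₃ v₂ (call childTerm (v₃ ∷ v₄ ∷ v₀ ∷ v₁ ∷ []))

opaque
  -- u c z v b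
  checkValueTerm : Term 5
  checkValueTerm = cond
    (cond (call compare (call evalCircuit (v₁ ∷ v₂ ∷ []) ∷ call evalCircuit (v₁ ∷ v₃ ∷ []) ∷ []))
      ∅ (fst (call compare (v₂ ∷ v₃ ∷ []))))
    ((∅ ▹ ∅) ▹ ∅)
    (∅ ▹ call childTerm (v₀ ∷ v₁ ∷ v₃ ∷ v₄ ∷ []))

opaque
  -- r b
  enterRowTerm : Term 2
  enterRowTerm = cond (fst (fst v₀)) (∅ ▹ cond v₁ (snd (snd v₀)) (fst (snd v₀)))
    (cond (snd (fst v₀)) (cond v₁ ∅ (∅ ▹ fst (snd v₀)))
                         (cond v₁ ((∅ ▹ ∅) ▹ ∅ ▹ ∅) ∅))

opaque
  -- u c z r m b
  stepTerm : Term 6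
  stepTerm = cond v₄
    (cond (fst v₄) v₄ (call checkValueTerm (v₀ ∷ v₁ ∷ v₂ ∷ snd v₄ ∷ v₅ ∷ [])))
    (call enterRowTerm (v₃ ∷ v₅ ∷ []))

opaque
  -- u c z q s
  checkTerm : Term 5
  checkTerm = fst (fold v₃ (∅ ▹ v₄) (bind (call readRowTerm (v₃ ∷ snd v₀ ∷ []))
    (call stepTerm (v₄ ∷ v₅ ∷ v₆ ∷ fst v₀ ∷ fst v₁ ∷ v₂ ∷ []) ▹ snd v₀)))

opaque
  -- m t
  acceptsTerm : Term 2
  acceptsTerm = cond v₀
    (cond (fst v₀) (snd v₀) (cond (call compare (snd v₀ ∷ v₁ ∷ [])) ∅ (∅ ▹ ∅)))
    (∅ ▹ ∅)

opaque
  -- u c q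
  targetTerm : Term 3
  targetTerm = bind (call walkTerm (v₀ ∷ v₁ ∷ v₂ ∷ v₂ ∷ []))
    (cond (fst v₀) ∅ (∅ ▹ ∅) ▹ snd v₀)

opaque
  -- u c s q z
  verdictTerm : Term 5
  verdictTerm = bind (call candidateTerm (v₀ ∷ v₂ ∷ []))
    (cond v₀
      (cond (call compare (call evalCircuit (v₂ ∷ v₅ ∷ []) ∷ snd v₀ ∷ []))
        (cond (call acceptsTerm
                (call checkTerm (v₁ ∷ v₂ ∷ v₅ ∷ v₄ ∷ v₃ ∷ []) ∷
                 call targetTerm (v₁ ∷ v₂ ∷ v₄ ∷ []) ∷ []))
          -- Reversing twice preserves bit strings that fit the clock and turns every other tree
          -- into some bit string.
          (∅ ▹ call rev (call rev (snd v₀ ∷ []) ∷ [])) ∅)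
        ∅)
      ∅)

opaque
  -- u c π₁ π₂
  splitTerm : Term 4
  splitTerm = bind (call split (v₀ ∷ v₃ ∷ []))
    (call verdictTerm (v₁ ∷ v₂ ∷ v₃ ∷ fst v₀ ∷ fst (call split (v₁ ∷ snd v₀ ∷ [])) ∷ []))

opaque
  -- x π₁ π₂
  verifier : Term 3
  verifier = bind (scan v₀ ∅ ((∅ ▹ ∅) ▹ v₀))
    (call splitTerm (snd v₀ ∷ snd (fst v₀) ∷ v₂ ∷ v₃ ∷ []))

iterate-ones : ∀ n → iterate (true ∷_) n [] ≡ ones n
iterate-ones n = trans (shift n 0) (cong ones (+-identityʳ n))
  where
  shift : ∀ m k → iterate (true ∷_) m (ones k) ≡ ones (m + k)
  shift zero    k = refl
  shift (suc m) k = trans (shift m (suc k)) (cong ones (+-suc m k))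

opaque
  unfolding verdictTerm

  -- An answer is owed on all inputs, including those that encode no circuit. Every branch ends in
  -- `nil` or in an output of `rev`.
  verdictTerm-canonical : ∀ N ρ → ∃[ m ] eval N verdictTerm ρ ≡ answerTree m
  verdictTerm-canonical N (u ∷ c ∷ s ∷ q ∷ z ∷ [])
    with eval N candidateTerm (u ∷ s ∷ [])
  ... | nil = nothing , refl
  ... | cons a y
    with eval N compare (eval N evalCircuit (c ∷ z ∷ []) ∷ y ∷ [])
  ... | nil = nothing , refl
  ... | cons _ _
    with eval N acceptsTerm (eval N checkTerm (u ∷ c ∷ z ∷ q ∷ s ∷ []) ∷
                              eval N targetTerm (u ∷ c ∷ q ∷ []) ∷ [])
  ... | nil = nothing , refl
  ... | cons _ _ with rev-canonical N (eval N rev (y ∷ []))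
  ...   | bs , eq = just bs , cong (cons nil) eq

-- Correctness of the verifier on descriptions of circuits

module _ {N n} (C : Circuit n (2 * n)) (n≤N : n ≤ N) (2n≤N : 2 * n ≤ N)
         (C≤N : length (circuitBits C) ≤ N) where

  open Korten ⟦ C ⟧

  private
    V = Vec Bool n
    V⟦_⟧ : ∀ {d} → Vec Bool d → Tree
    V⟦ v ⟧ = bitsTree (toList v)
    u c : Tree
    u = bitsTree (ones n)
    c = bitsTree (circuitBits C)

    ones≤N : length (ones n) ≤ N
    ones≤N = ≤-trans (≤-reflexive (length-replicate n)) n≤N

    bits≤N : (v : V) → length (toList v) ≤ N
    bits≤N v = ≤-trans (≤-reflexive (Vec.length-toList v)) n≤N

    answer≤N : ∀ (y : Vec Bool (2 * n)) → length (toList y) ≤ N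
    answer≤N y = ≤-trans (≤-reflexive (Vec.length-toList y)) 2n≤N

  opaque
    unfolding readRowTerm

    eval-readRow : ∀ s → let r , s′ = readRow {n} s in
      eval N readRowTerm (u ∷ bitsTree s ∷ []) ≡ cons (rowTree r) (bitsTree s′)
    eval-readRow s
      rewrite right-bitsTree s | left-bitsTree s | right-bitsTree (tailBits s) | left-bitsTree (tailBits s)
            | eval-split {N} n (tailBits (tailBits s)) n≤N
            | eval-split {N} n (proj₂ (read n (tailBits (tailBits s)))) n≤N = refl

  eval-join : (v w : V) → eval N append (V⟦ v ⟧ ∷ V⟦ w ⟧ ∷ []) ≡ V⟦ join (v , w) ⟧
  eval-join v w = trans
    (eval-append N (toList v) (toList w)
      (subst (λ s → length s ≤ N) eq (answer≤N (join (v , w)))))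
    (cong bitsTree (sym eq))
    where
    eq : answerBits (v , w) ≡ toList v ++ toList w
    eq = trans (toList-join v w) (cong (toList v ++_) (++-identityʳ (toList w)))

  stopped : Row n → Maybe (V × V)
  stopped (row t _ v w) = when t then just (v , w) else nothing

  candidateStep : Maybe (V × V) × Bits → Bool → Maybe (V × V) × Bits
  candidateStep (m , s) _ = let r , s′ = readRow s in m <∣> stopped r , s′

  answerTree′ : Maybe (V × V) → Tree
  answerTree′ m = answerTree (Maybe.map answerBits m)

  opaque
    unfolding candidateTerm

    eval-candidate : ∀ s → eval N candidateTerm (u ∷ bitsTree s ∷ []) ≡
      answerTree (Maybe.map answerBits (candidate (rows n s)))
    eval-candidate s = trans (cong left
      (eval-fold N (pairTree answerTree′ bitsTree) _ {l = v₀} {i = ∅ ▹ v₁} candidateStep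
        body-step (ones n) {nothing , s} ones≤N refl refl))
      (cong answerTree′ (steps n nothing s))
      where
      body-step : ∀ a b t →
        eval N (bind (call readRowTerm (v₃ ∷ snd v₀ ∷ []))
          (cond (fst v₁) (fst v₁)
            (cond (fst (fst (fst v₀)))
              (∅ ▹ call append (fst (snd (fst v₀)) ∷ snd (snd (fst v₀)) ∷ [])) ∅) ▹ snd v₀))
          (pairTree answerTree′ bitsTree a ∷ bitTree b ∷ t ∷ u ∷ bitsTree s ∷ [])
        ≡ pairTree answerTree′ bitsTree (candidateStep a b)
      body-step (m , s) b t
        rewrite eval-readRow s
        with m | headBit s
      ... | just _  | _     = refl
      ... | nothing | true  = cons₂ (cons₂ refl (eval-join _ _)) refl
      ... | nothing | false = refl
      steps : ∀ d m s → proj₁ (foldl candidateStep (m , s) (ones d)) ≡ (m <∣> candidate (rows d s))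
      steps zero    nothing  s = refl
      steps zero    (just y) s = refl
      steps (suc d) (just y) s = steps d (just y) _
      steps (suc d) nothing  s with headBit s
      ... | true  = steps d (just _) _
      ... | false = steps d nothing _

  opaque
    unfolding childTerm

    eval-child : ∀ v b → eval N childTerm (u ∷ c ∷ V⟦ v ⟧ ∷ bitTree b ∷ []) ≡ V⟦ child b v ⟧
    eval-child v b
      rewrite eval-evalCircuit {N} C v C≤N
            | eval-split {N} n (toList (⟦ C ⟧ v)) n≤N
            | eval-split {N} n (proj₂ (read n (toList (⟦ C ⟧ v)))) n≤N
      with b
    ... | true  = refl
    ... | false = refl

  opaque
    unfolding walkTerm

    eval-walk : ∀ v (q : V) → eval N walkTerm (u ∷ c ∷ V⟦ v ⟧ ∷ V⟦ q ⟧ ∷ []) ≡ V⟦ walk v q ⟧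
    eval-walk v q = trans
      (eval-fold N V⟦_⟧ _ {l = v₃} {i = v₂} (λ v b → child b v)
        (λ v b t → eval-child v b) (toList q) {v} (bits≤N q) refl refl)
      (cong V⟦_⟧ (steps v q))
      where
      steps : ∀ {d} v (q : Vec Bool d) → foldl (λ v b → child b v) v (toList q) ≡ walk v q
      steps v []      = refl
      steps v (b ∷ q) = steps (child b v) q

  opaque
    unfolding checkValueTerm

    eval-checkValue : ∀ z v b → eval N checkValueTerm (u ∷ c ∷ V⟦ z ⟧ ∷ V⟦ v ⟧ ∷ bitTree b ∷ []) ≡
                                modeTree (checkValue z v b)
    eval-checkValue z v b
      rewrite eval-evalCircuit {N} C v C≤N | eval-evalCircuit {N} C z C≤N
            | eval-compare {N} (⟦ C ⟧ z) (⟦ C ⟧ v) 2n≤N | eval-compare {N} z v n≤N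
            | eval-child v b
      with compareBits (⟦ C ⟧ z) (⟦ C ⟧ v) | compareBits z v
    ... | just _  | _          = refl
    ... | nothing | nothing    = refl
    ... | nothing | just true  = refl
    ... | nothing | just false = refl

  opaque
    unfolding enterRowTerm

    eval-enterRow : ∀ (r : Row n) b →
      eval N enterRowTerm (rowTree r ∷ bitTree b ∷ []) ≡ modeTree (enterRow r b)
    eval-enterRow (row true  _     v w) true  = refl
    eval-enterRow (row true  _     v w) false = refl
    eval-enterRow (row false true  v w) true  = refl
    eval-enterRow (row false true  v w) false = refl
    eval-enterRow (row false false v w) true  = refl
    eval-enterRow (row false false v w) false = refl

  opaque
    unfolding stepTerm

    eval-step : ∀ z r m b →
      eval N stepTerm (u ∷ c ∷ V⟦ z ⟧ ∷ rowTree r ∷ modeTree m ∷ bitTree b ∷ []) ≡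
      modeTree (step z r m b)
    eval-step z r descend     b = eval-enterRow r b
    eval-step z r (holds v)   b = eval-checkValue z v b
    eval-step z r (decided _) b = refl

  checkStep : V → Mode n × Bits → Bool → Mode n × Bits
  checkStep z (m , s) b = let r , s′ = readRow s in step z r m b , s′

  opaque
    unfolding checkTerm

    eval-check : ∀ z (q : V) s →
      eval N checkTerm (u ∷ c ∷ V⟦ z ⟧ ∷ V⟦ q ⟧ ∷ bitsTree s ∷ []) ≡
      modeTree (check z descend (rows n s) q)
    eval-check z q s = trans (cong left
      (eval-fold N (pairTree modeTree bitsTree) _ {l = v₃} {i = ∅ ▹ v₄} (checkStep z) body-step
        (toList q) {descend , s} (bits≤N q) refl refl))
      (cong modeTree (steps descend s q))
      where
      body-step : ∀ a b t →
        eval N (bind (call readRowTerm (v₃ ∷ snd v₀ ∷ []))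
          (call stepTerm (v₄ ∷ v₅ ∷ v₆ ∷ fst v₀ ∷ fst v₁ ∷ v₂ ∷ []) ▹ snd v₀))
          (pairTree modeTree bitsTree a ∷ bitTree b ∷ t ∷ u ∷ c ∷ V⟦ z ⟧ ∷ V⟦ q ⟧ ∷ bitsTree s ∷ [])
        ≡ pairTree modeTree bitsTree (checkStep z a b)
      body-step (m , s) b t rewrite eval-readRow s = cons₂ (eval-step z _ m b) refl
      steps : ∀ {d} m s (q : Vec Bool d) →
              proj₁ (foldl (checkStep z) (m , s) (toList q)) ≡ check z m (rows d s) q
      steps m s []      = refl
      steps m s (b ∷ q) = steps _ _ q

  opaque
    unfolding acceptsTerm

    eval-accepts : ∀ m (t : V) →
      eval N acceptsTerm (modeTree m ∷ V⟦ t ⟧ ∷ []) ≡ bitTree (accepts m t)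
    eval-accepts descend     t = refl
    eval-accepts (decided b) t = refl
    eval-accepts (holds v)   t rewrite eval-compare {N} v t n≤N with compareBits v t
    ... | just _  = refl
    ... | nothing = refl

  opaque
    unfolding targetTerm

    eval-target : ∀ q → 1 ≤ n → eval N targetTerm (u ∷ c ∷ V⟦ q ⟧ ∷ []) ≡ V⟦ target q ⟧
    eval-target q n≥1 rewrite eval-walk q q = flip n≥1 (walk q q)
      where
      -- For d = 0 the term would produce a string of one bit.
      flip : ∀ {d} → 1 ≤ d → (v : Vec Bool d) →
             cons (branch (left V⟦ v ⟧) nil (cons nil nil)) (right V⟦ v ⟧) ≡ V⟦ flipHead v ⟧
      flip _ (false ∷ v) = refl
      flip _ (true ∷ v)  = refl

  opaque
    unfolding verdictTerm

    eval-verdict : 1 ≤ n → ∀ s q z →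
      eval N verdictTerm (u ∷ c ∷ bitsTree s ∷ V⟦ q ⟧ ∷ V⟦ z ⟧ ∷ []) ≡
      answerTree (Maybe.map answerBits (verdict target (rows n s) q z))
    eval-verdict n≥1 s q z
      rewrite eval-candidate s | eval-check z q s | eval-target q n≥1
            | eval-accepts (check z descend (rows n s) q) (target q)
            | eval-evalCircuit {N} C z C≤N
      with candidate (rows n s)
    ... | nothing = refl
    ... | just y
      rewrite eval-compare {N} (⟦ C ⟧ z) (join y) 2n≤N
            | eval-rev N (answerBits y) (answer≤N (join y))
            | eval-rev N (reverse (answerBits y))
                (≤-trans (≤-reflexive (length-reverse (answerBits y))) (answer≤N (join y)))
            | reverse-involutive (answerBits y)
      with compareBits (⟦ C ⟧ z) (join y) | accepts (check z descend (rows n s) q) (target q)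
    ... | nothing | _     = refl
    ... | just _  | true  = refl
    ... | just _  | false = refl

  opaque
    unfolding splitTerm

    eval-splitTerm : 1 ≤ n → ∀ π₁ π₂ → let q , s = read n π₂ ; z , _ = read n s in
      eval N splitTerm (u ∷ c ∷ bitsTree π₁ ∷ bitsTree π₂ ∷ []) ≡
      answerTree (Maybe.map answerBits (verdict target (rows n π₁) q z))
    eval-splitTerm n≥1 π₁ π₂
      rewrite eval-split {N} n π₂ n≤N | eval-split {N} n (proj₂ (read n π₂)) n≤N =
      eval-verdict n≥1 π₁ _ _

  opaque
    unfolding verifier

    eval-verifier : 1 ≤ n → ∀ π₁ π₂ → let q , s = read n π₂ ; z , _ = read n s in
      eval N verifier (bitsTree (encode C) ∷ bitsTree π₁ ∷ bitsTree π₂ ∷ []) ≡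
      answerTree (Maybe.map answerBits (verdict target (rows n π₁) q z))
    eval-verifier n≥1 π₁ π₂
      rewrite eval-scan N bitsTree (bitsTree (encode C) ∷ bitsTree π₁ ∷ bitsTree π₂ ∷ [])
                {l = v₀} {i = ∅} {u = (∅ ▹ ∅) ▹ v₀} (true ∷_) (λ _ _ → refl)
                n {a = []} n≤N refl refl
            | iterate-ones n =
      eval-splitTerm n≥1 π₁ π₂

opaque
  unfolding splitTerm verifier

  verifier-canonical : ∀ N ρ → ∃[ m ] eval N verifier ρ ≡ answerTree m
  verifier-canonical N (_ ∷ _ ∷ _ ∷ []) = verdictTerm-canonical N _

-- The algorithm and its output

arguments : Bits → Bits → Bits → Vec Tree 3
arguments x π₁ π₂ = bitsTree x ∷ bitsTree π₁ ∷ bitsTree π₂ ∷ []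

-- Read off from the value of the term, so that agreement with the program is immediate; the link
-- with `Korten.verdict` is made only for encodings of circuits, in `verify-verdict`.
verify : Bits → Bits → Bits → Maybe Bits
verify x π₁ π₂ = proj₁ (verifier-canonical (length x) (arguments x π₁ π₂))

verify-time : PolynomialTime verify
verify-time = 1 , program , bound program , λ x π₁ π₂ →
  let runs {t} r t≤ = set ⨟ compile-runs x verifier (arguments x π₁ π₂) ⨟ set
  in  t , _ , r ,
      -- All loops are clocked by x, so the time is bounded in the length of x alone.
      ≤-trans t≤ (⟪⟫-mono (bound program)
        (≤-trans (m≤m+n (length x) (length π₁)) (m≤m+n _ (length π₂)))) ,
      proj₂ (verifier-canonical (length x) (arguments x π₁ π₂))
  where
  program : Command 4
  -- At the start K, E and R hold x, π₁ and π₂, and the one extra variable S is the empty stack.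
  program = E ≔ cons (var K) (cons (var E) (cons (var R) nil)) ⨾ compile verifier ⨾ K ≔ var R

bitsTree-injective : ∀ as bs → bitsTree as ≡ bitsTree bs → as ≡ bs
bitsTree-injective []           []           eq = refl
bitsTree-injective (false ∷ as) (false ∷ bs) eq =
  cong (false ∷_) (bitsTree-injective as bs (cong right eq))
bitsTree-injective (true ∷ as)  (true ∷ bs)  eq =
  cong (true ∷_) (bitsTree-injective as bs (cong right eq))
bitsTree-injective (false ∷ as) (true ∷ bs)  ()
bitsTree-injective (true ∷ as)  (false ∷ bs) ()

answerTree-injective : ∀ m m′ → answerTree m ≡ answerTree m′ → m ≡ m′
answerTree-injective nothing   nothing   eq = refl
answerTree-injective (just as) (just bs) eq = cong just (bitsTree-injective as bs (cong right eq))

-- At least n (2 + 2 n) for every n ≤ N, the length of n rows.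
proofLength : Polynomial
proofLength = 0 ∷ 2 ∷ 2 ∷ []

avoider : SingleValuedFΣ₂P
avoider = record { ℓ = proofLength ; V = verify ; V-time = verify-time }

-- Certificates have a prescribed length, whereas `rows` and `read` look only at a prefix; the junk
-- comes after it.
pad : ∀ {m} bs → length bs ≤ m → ∃[ v ] ∃[ junk ] toList {n = m} v ≡ bs ++ junk
pad []       _        = Vec.replicate _ false , _ , refl
pad (b ∷ bs) (s≤s ≤m) with pad bs ≤m
... | v , junk , eq = b ∷ v , junk , cong (b ∷_) eq

-- Yields 2n ≤ N, so that loops over images of the circuit fit the clock.
length-outputBits : ∀ {w m} (is : Vec (Fin w) m) → m ≤ length (outputBits is)
length-outputBits []       = z≤n
length-outputBits (i ∷ is) = subst (_ ≤_) (sym (length-unary (toℕ i) (outputBits is)))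
  (s≤s (≤-trans (length-outputBits is) (m≤n+m _ (toℕ i))))

module _ {n} (n≥1 : n ≥ 1) (C : Circuit n (2 * n)) where

  open Korten ⟦ C ⟧

  private
    N = length (encode C)

    n≤N : n ≤ N
    n≤N = unary-≤ n (circuitBits C) ≤-refl

    C≤N : length (circuitBits C) ≤ N
    C≤N = rest-≤ n (circuitBits C) ≤-refl

    2n≤N : 2 * n ≤ N
    2n≤N = ≤-trans (length-outputBits (Circuit.outputs C))
                   (suffix-≤ (encodeGates (Circuit.gates C)) C≤N)

    -- `⟪ proofLength ⟫ N` is N * (2 + N * (2 + N * 0)), which has the shape N * (2 + a) at both
    -- levels.
    double≤ : ∀ a → n + n ≤ N * (2 + a)
    double≤ a = ≤-trans (≤-reflexive (trans (cong (n +_) (sym (+-identityʳ n))) (*-comm 2 n)))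
                        (*-mono-≤ n≤N (m≤m+n 2 a))

    challenge≤ : (q z : Vec Bool n) → length (toList q ++ toList z) ≤ ⟪ proofLength ⟫ N
    challenge≤ q z = ≤-trans (≤-reflexive (trans (length-++ (toList q))
      (cong₂ _+_ (Vec.length-toList q) (Vec.length-toList z)))) (double≤ _)

    rows≤ : n * (2 + (n + n)) ≤ ⟪ proofLength ⟫ N
    rows≤ = *-mono-≤ n≤N (+-monoʳ-≤ 2 (double≤ _))

  verify-verdict : ∀ π₁ π₂ {q z s s′} → read n π₂ ≡ (q , s) → read n s ≡ (z , s′) →
    verify (encode C) π₁ π₂ ≡ Maybe.map answerBits (verdict target (rows n π₁) q z)
  verify-verdict π₁ π₂ refl refl = answerTree-injective _ _ (trans
    (sym (proj₂ (verifier-canonical N (arguments (encode C) π₁ π₂))))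
    (eval-verifier C n≤N 2n≤N C≤N n≥1 π₁ π₂))

  failure-output : ∀ {y} → Failure n target y → Outputs avoider (encode C) (answerBits y)
  failure-output f = exists , forall₁
    where
    exists : ∃[ π₁ ] ∀ π₂ → verify (encode C) (toList π₁) (toList π₂) ≡ just _
    exists with honest f
    ... | rs , acc with pad (rowsBits rs) (≤-trans (≤-reflexive (length-rowsBits rs)) rows≤)
    ...   | π₁ , junk , eq = π₁ , λ π₂ → trans (verify-verdict (toList π₁) (toList π₂) refl refl)
      (cong (Maybe.map answerBits) (trans
        (cong (λ rs → verdict target rs _ _) (trans (cong (rows n) eq) (rows-rowsBits rs junk)))
        (acc _ _)))

    forall₁ : ∀ π₁ → ∃[ π₂ ] (verify (encode C) (toList π₁) (toList π₂) ≡ just _ ⊎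
                               verify (encode C) (toList π₁) (toList π₂) ≡ nothing)
    forall₁ π₁ with single-valued f (rows n (toList π₁))
    ... | q , z , answers with pad (toList q ++ toList z) (challenge≤ q z)
    ...   | π₂ , junk , eq = π₂ , Sum.map translate translate answers
      where
      agree = verify-verdict (toList π₁) (toList π₂)
        (trans (cong (read n) (trans eq (++-assoc (toList q) (toList z) junk))) (read-toList q _))
        (read-toList z junk)
      translate : ∀ {m} → verdict target (rows n (toList π₁)) q z ≡ m →
                  verify (encode C) (toList π₁) (toList π₂) ≡ Maybe.map answerBits m
      translate = trans agree ∘ cong (Maybe.map answerBits)

mainTheorem11 : Σ[ A ∈ SingleValuedFΣ₂P ]
    ((n : ℕ) → n ≥ 1 → (C : Circuit n (2 * n)) →
    Σ[ y ∈ Vec Bool (2 * n) ]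
    (Outputs A (encode C) (toList y) × ¬ (y ∈Im C)))
mainTheorem11 = avoider , λ n n≥1 C →
  let y , f = Korten.root-failure ⟦ C ⟧ n≥1
  in  join y , failure-output n≥1 C f , λ (x , eq) → Korten.failure-avoids ⟦ C ⟧ f x eq
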